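{- Let $q$ be an odd prime power and $t>4$ an integer, and put $n=2t$. If $t$ is even and $q>3$, or $t$ is odd and $q>5$, then there exists $m\in\mathbb{F}_{q^t}$ such that \[\varphi_{m,q}=X^{q^{t-1}}+X^{q^{2t-1}}+m\left(X^{q}-X^{q^{t+1}}\right)\in\mathbb{F}_{q^{2t}}[X]\] is a scattered $q$-polynomial which is not equivalent to any polynomial in the following three families of scattered $q$-polynomials in $\mathbb{F}_{q^{2t}}[X]$: (i) $X^{q^s}$ with $\gcd(s,n)=1$ (pseudoregulus type); (ii) $X^{q^{n-s}}+\delta X^{q^s}$ with $\gcd(s,n)=1$ and $\delta^{\frac{q^n-1}{q-1}}\neq 0,1$ (Lunardon–Polverino type); (iii) $\psi_{s,h}=X^{q^s}+X^{q^{s(t-1)}}+h^{1+q^{s}}X^{q^{s(t+1)}}+h^{1-q^{s(2t-1)}}X^{q^{s(2t-1)}}$ with $\gcd(s,2t)=1$, $h\in\mathbb{F}_{q^{2t}}$ and $h^{q^t+1}=-1$.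
   Context: A $q$-polynomial over $\mathbb{F}_{q^n}$ is a polynomial $f=\sum_i a_iX^{q^i}$ with $a_i\in\mathbb{F}_{q^n}$, considered modulo $X^{q^n}-X$, i.e. identified with the $\mathbb{F}_q$-linear map $x\mapsto f(x)$ of $\mathbb{F}_{q^n}$. Such $f$ is scattered if for all $x,y\in\mathbb{F}_{q^n}^*$, $f(x)/x=f(y)/y$ implies $x/y\in\mathbb{F}_q$. The graph of $f$ is $U_f=\{(x,f(x)) : x\in\mathbb{F}_{q^n}\}\subseteq\mathbb{F}_{q^n}^2$. Two $q$-polynomials $f,g$ are equivalent if $U_f$ and $U_g$ lie in the same orbit under the natural action of $\Gamma\mathrm{L}(2,q^n)$ on $\mathbb{F}_{q^n}^2$ (i.e., there are $M\in\mathrm{GL}(2,q^n)$ and a field automorphism $\tau$ of $\mathbb{F}_{q^n}$ with $\{M(x^\tau,f(x)^\tau)^T\}=U_g$). -}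

module Defs where

open import Level using (Level; _⊔_)
open import Data.Nat as ℕ using (ℕ; zero; suc; _∸_; _≤_; _<_)
open import Data.Nat.Primality using (Prime)
open import Data.Nat.GCD using (gcd)
open import Data.Nat.DivMod using (_/_; _%_)
open import Data.Fin using (Fin)
open import Data.Product using (Σ; ∃; _×_; _,_)
open import Relation.Binary.PropositionalEquality using (_≡_)
open import Relation.Nullary using (¬_)
open import Algebra.Bundles using (CommutativeRing)

IsPrimePower : ℕ → Set
IsPrimePower q = Σ ℕ λ p → Σ ℕ λ k → Prime p × 1 ≤ k × q ≡ p ℕ.^ k

-- (q^n - 1)/(q - 1) = 1 + q + ... + q^{n-1}  (exact quotient, q ≥ 2)
normExp : ℕ → ℕ → ℕ
normExp q zero = 0
normExp q (suc n) = q ℕ.^ n ℕ.+ normExp q n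

IsOdd : ℕ → Set
IsOdd q = q % 2 ≡ 1

module FieldNotions {c ℓ : Level} (R : CommutativeRing c ℓ) where
  open CommutativeRing R renaming (Carrier to F)

  pow : F → ℕ → F
  pow x zero = 1#
  pow x (suc n) = x * pow x n

  IsField : Set (c ⊔ ℓ)
  IsField = (¬ (0# ≈ 1#)) × (∀ x → ¬ (x ≈ 0#) → Σ F λ y → x * y ≈ 1#)

  HasCardinality : ℕ → Set (c ⊔ ℓ)
  HasCardinality N =
    Σ (Fin N → F) λ e →
      (∀ i j → e i ≈ e j → i ≡ j) × (∀ x → Σ (Fin N) λ i → e i ≈ x)

  -- a q-polynomial viewed as its F_q-linear map x ↦ f(x)
  Map : Set c
  Map = F → F

  frob : ℕ → ℕ → Map
  frob q i x = pow x (q ℕ.^ i)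

  InSubfield : ℕ → ℕ → F → Set ℓ
  InSubfield q k z = pow z (q ℕ.^ k) ≈ z

  Scattered : ℕ → Map → Set (c ⊔ ℓ)
  Scattered q f = ∀ x y xi yi → ¬ (x ≈ 0#) → ¬ (y ≈ 0#) →
    x * xi ≈ 1# → y * yi ≈ 1# →
    f x * xi ≈ f y * yi → InSubfield q 1 (x * yi)

  IsFieldAut : (F → F) → Set (c ⊔ ℓ)
  IsFieldAut τ =
    (∀ x y → x ≈ y → τ x ≈ τ y) ×
    (∀ x y → τ (x + y) ≈ τ x + τ y) ×
    (∀ x y → τ (x * y) ≈ τ x * τ y) ×
    (τ 1# ≈ 1#) ×
    (∀ x y → τ x ≈ τ y → x ≈ y) ×
    (∀ y → Σ F λ x → τ x ≈ y)

  -- f and g are equivalent: some (M, τ) ∈ ΓL(2, F), M = [[a, b], [c, d]],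
  -- maps U_f = {(x, f x)} onto U_g = {(y, g y)}, i.e.
  -- { M (x^τ, f(x)^τ)^T : x ∈ F } = U_g
  Equivalent : Map → Map → Set (c ⊔ ℓ)
  Equivalent f g =
    Σ F λ a → Σ F λ b → Σ F λ c' → Σ F λ d → Σ (F → F) λ τ →
      ¬ ((a * d - b * c') ≈ 0#) × IsFieldAut τ ×
      (∀ x → Σ F λ y →
         (a * τ x + b * τ (f x) ≈ y) × (c' * τ x + d * τ (f x) ≈ g y)) ×
      (∀ y → Σ F λ x →
         (a * τ x + b * τ (f x) ≈ y) × (c' * τ x + d * τ (f x) ≈ g y))

  phi : ℕ → ℕ → F → Map
  phi q t m x = frob q (t ∸ 1) x + frob q (2 ℕ.* t ∸ 1) x
                + m * (frob q 1 x - frob q (t ℕ.+ 1) x)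

  PseudoregulusType : ℕ → ℕ → Map → Set (c ⊔ ℓ)
  PseudoregulusType q n g =
    Σ ℕ λ s → gcd s n ≡ 1 × (∀ x → g x ≈ frob q s x)

  LPType : ℕ → ℕ → Map → Set (c ⊔ ℓ)
  LPType q n g =
    Σ ℕ λ s → Σ F λ δ → gcd s n ≡ 1 ×
      ¬ (pow δ (normExp q n) ≈ 0#) ×
      ¬ (pow δ (normExp q n) ≈ 1#) ×
      (∀ x → g x ≈ frob q (n ∸ s) x + δ * frob q s x)

  -- (iii) ψ_{s,h} = X^{q^s} + X^{q^{s(t-1)}} + h^{1+q^s} X^{q^{s(t+1)}}
  --                 + h^{1-q^{s(2t-1)}} X^{q^{s(2t-1)}},
  -- gcd(s, 2t) = 1, h^{q^t+1} = -1; here h^{1-q^k} = h · (h⁻¹)^{q^k}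
  PsiType : ℕ → ℕ → Map → Set (c ⊔ ℓ)
  PsiType q t g =
    Σ ℕ λ s → Σ F λ h → Σ F λ hi → gcd s (2 ℕ.* t) ≡ 1 ×
      h * hi ≈ 1# × pow h (q ℕ.^ t ℕ.+ 1) ≈ - 1# ×
      (∀ x → g x ≈ frob q s x + frob q (s ℕ.* (t ∸ 1)) x
                   + pow h (1 ℕ.+ q ℕ.^ s) * frob q (s ℕ.* (t ℕ.+ 1)) x
                   + (h * pow hi (q ℕ.^ (s ℕ.* (2 ℕ.* t ∸ 1))))
                       * frob q (s ℕ.* (2 ℕ.* t ∸ 1)) x)

{-# OPTIONS --safe #-}
module Submission where

-- Let F be the field with q²ᵗ elements, σ its Frobenius x ↦ x^q, x̄ = x^(qᵗ), K = {x̄ = x} and V = {x̄ = -x}.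
-- Then F = K ⊕ V, and φ(u + v) = 2 (σ⁻¹u + m σv) for u ∈ K, v ∈ V, where σ⁻¹ is the inverse of σ on K.
--
-- Scatteredness. If φ(x) = α x, put a = α + ᾱ, b = α - ᾱ, P = x + x̄, Q = x - x̄; then 4 σ⁻¹P = a P + b Q and
-- 4 m σQ = a Q + b P. For two such x, x′ and W = P Q′ - P′ Q these equations give m σ(a W) = a W, so a W = 0
-- because N(m) ≠ 1. If W = 0, then x / x′ lies in K and the equations show that σ fixes it. Otherwise a = 0 and
-- m = (b/4) σ(b/4) with b/4 ∈ V. Counting roots yields an m ∈ K with N(m) ≠ 1 that is not of this form.
--
-- Inequivalence. Every g in the three families is a sum g₊ + g₋ of additive maps that are semilinear over K with
-- respect to σˢ and σ⁻ˢ. As 1, σ, …, σ^(t - 1) are independent on K, the identity g(a x + b φ(x)) = c x + d φ(x)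
-- can be compared degree by degree on K and on V = K w. If s ≢ ±1 mod t, this gives c = d = 0. If s ≡ 1, it gives
-- g₊(a) = g₊(2 b μ) = 0, g₊(2 b) = c, g₊(a w) = 2 d μ, g₋(2 b) = g₋(a w) = 0, g₋(a) = 2 d, g₋(2 b μ) = c w with
-- μ = m σw, and s ≡ -1 is the same with g₊, g₋ exchanged. In (i) and (ii) g₊ is injective, whence a = b = 0. In (iii)
-- a zero y of g± determines N(g±(y w)) = N(2 y w), and comparing norms in these equations forces N(m) = 1.

open import Level using (Level; _⊔_)
open import Algebra.Bundles using (CommutativeRing)
open import Data.Empty using (⊥)
open import Data.Fin.Base as Fin using (Fin; toℕ; inject₁; fromℕ)
import Data.Fin.Properties as Fin
open import Data.Fin.Permutation using (Permutation; permutation; _⟨$⟩ʳ_)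
open import Data.Integer.Base as ℤ using (ℤ; +_; -[1+_]; _⊖_; 0ℤ; 1ℤ)
import Data.Integer.Properties as ℤ
open import Data.List.Base using (List; []; _∷_; length; tabulate)
open import Data.List.Properties using (length-tabulate)
open import Data.List.Relation.Unary.All as All using (All; []; _∷_)
open import Data.List.Relation.Unary.All.Properties using (¬All⇒Any¬)
open import Data.List.Relation.Unary.AllPairs using (AllPairs; []; _∷_)
import Data.List.Relation.Unary.AllPairs.Properties as AllPairs
import Data.List.Relation.Unary.Any as Any
open import Data.Maybe.Base as Maybe using (Maybe)
open import Data.Nat.Base as ℕ using (ℕ; zero; suc)
open import Data.Nat.Combinatorics using (_C_; nCn≡1; nCk≡n!/k![n-k]!; k![n∸k]!∣n!)
open import Data.Nat.Divisibility as ∣ using (_∣_; _∤_; divides)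
open import Data.Nat.DivMod using (_/_; _%_; m≡m%n+[m/n]*n; m%n<n; m/n*n≡m)
open import Data.Nat.GCD using (gcd; gcd-greatest)
open import Data.Nat.Primality using (Prime; euclidsLemma; prime⇒nonZero; prime⇒nonTrivial)
import Data.Nat.Properties as ℕ
open import Data.Nat.Tactic.RingSolver using (solve-∀)
open import Data.Product.Base using (Σ; ∃; _×_; _,_; proj₁; proj₂)
open import Data.Sum.Base using (_⊎_; inj₁; inj₂)
open import Data.Vec.Functional using (Vector; removeAt; replicate)
open import Function.Base using (_∘_; _$_)
open import Relation.Binary.PropositionalEquality as ≡ using (_≡_; _≢_)
open import Relation.Nullary using (¬_; Dec; yes; no; contradiction)
open import Relation.Nullary.Decidable using (_⊎-dec_; decidable-stable; dec⇒maybe)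
open import Relation.Unary using (Decidable)
open import Defs

-- Ring solver with integer coefficients

module IntegerSolver {c ℓ : Level} (R : CommutativeRing c ℓ) where
  open CommutativeRing R renaming (Carrier to F)
  open import Algebra.Properties.Semiring.Mult.TCOptimised semiring
    using (×-homo-+; ×1-homo-*) renaming (_×_ to _·_)
  open import Algebra.Properties.Ring ring
  open import Algebra.Solver.Ring.AlmostCommutativeRing
  open import Relation.Binary.Reasoning.Setoid setoid

  -- The canonical homomorphism from ℤ. Integer coefficients have decidable equality, so the solver
  -- can cancel terms over any commutative ring.
  fromℤ : ℤ → F
  fromℤ (+ n)    = n · 1#
  fromℤ -[1+ n ] = - (suc n · 1#)

  private
    suc-· : ∀ n → suc n · 1# ≈ 1# + n · 1#
    suc-· n = ×-homo-+ 1# 1 n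

  fromℤ-⊖ : ∀ m n → fromℤ (m ⊖ n) ≈ m · 1# - n · 1#
  fromℤ-⊖ zero    zero    = sym (-‿inverseʳ 0#)
  fromℤ-⊖ zero    (suc n) = sym (+-identityˡ _)
  fromℤ-⊖ (suc m) zero    = sym (trans (+-congˡ -0#≈0#) (+-identityʳ _))
  fromℤ-⊖ (suc m) (suc n) = begin
    fromℤ (suc m ⊖ suc n)                    ≡⟨ ≡.cong fromℤ (ℤ.[1+m]⊖[1+n]≡m⊖n m n) ⟩
    fromℤ (m ⊖ n)                            ≈⟨ fromℤ-⊖ m n ⟩
    m · 1# - n · 1#                          ≈⟨ +-congʳ (+-identityʳ _) ⟨
    (m · 1# + 0#) - n · 1#                   ≈⟨ +-congʳ (+-congˡ (-‿inverseʳ 1#)) ⟨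
    (m · 1# + (1# - 1#)) - n · 1#            ≈⟨ +-congʳ (+-assoc _ _ _) ⟨
    ((m · 1# + 1#) - 1#) - n · 1#            ≈⟨ +-congʳ (+-congʳ (+-comm _ _)) ⟩
    ((1# + m · 1#) - 1#) - n · 1#            ≈⟨ +-assoc _ _ _ ⟩
    (1# + m · 1#) + (- 1# - n · 1#)          ≈⟨ +-congˡ (-‿+-comm _ _) ⟩
    (1# + m · 1#) - (1# + n · 1#)            ≈⟨ +-cong (suc-· m) (-‿cong (suc-· n)) ⟨
    suc m · 1# - suc n · 1#                  ∎

  fromℤ-neg : ∀ i → fromℤ (ℤ.- i) ≈ - fromℤ i
  fromℤ-neg (+ zero)  = sym -0#≈0#
  fromℤ-neg (+ suc n) = refl
  fromℤ-neg -[1+ n ]  = sym (-‿involutive _)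

  fromℤ-+ : ∀ i j → fromℤ (i ℤ.+ j) ≈ fromℤ i + fromℤ j
  fromℤ-+ (+ m)    (+ n)    = ×-homo-+ 1# m n
  fromℤ-+ (+ m)    -[1+ n ] = fromℤ-⊖ m (suc n)
  fromℤ-+ -[1+ m ] (+ n)    = trans (fromℤ-⊖ n (suc m)) (+-comm _ _)
  fromℤ-+ -[1+ m ] -[1+ n ] = trans (-‿cong (trans
    (reflexive (≡.cong (λ k → suc k · 1#) (≡.sym (ℕ.+-suc m n))))
    (×-homo-+ 1# (suc m) (suc n)))) (sym (-‿+-comm _ _))

  fromℤ-* : ∀ i j → fromℤ (i ℤ.* j) ≈ fromℤ i * fromℤ j
  fromℤ-* (+ m)    (+ n)    = trans (reflexive (≡.cong fromℤ (≡.sym (ℤ.pos-* m n)))) (×1-homo-* m n)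
  fromℤ-* i@(+ _)  -[1+ n ] = begin
    fromℤ (i ℤ.* -[1+ n ])     ≡⟨ ≡.cong fromℤ (ℤ.neg-distribʳ-* i (+ suc n)) ⟨
    fromℤ (ℤ.- (i ℤ.* + suc n)) ≈⟨ fromℤ-neg (i ℤ.* + suc n) ⟩
    - fromℤ (i ℤ.* + suc n)    ≈⟨ -‿cong (fromℤ-* i (+ suc n)) ⟩
    - (fromℤ i * (suc n · 1#)) ≈⟨ -‿distribʳ-* _ _ ⟩
    fromℤ i * fromℤ -[1+ n ]   ∎
  fromℤ-* -[1+ m ] (+ n) = begin
    fromℤ (-[1+ m ] ℤ.* + n)      ≡⟨ ≡.cong fromℤ (ℤ.neg-distribˡ-* (+ suc m) (+ n)) ⟨
    fromℤ (ℤ.- (+ suc m ℤ.* + n)) ≈⟨ fromℤ-neg (+ suc m ℤ.* + n) ⟩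
    - fromℤ (+ suc m ℤ.* + n)     ≈⟨ -‿cong (fromℤ-* (+ suc m) (+ n)) ⟩
    - ((suc m · 1#) * (n · 1#))   ≈⟨ -‿distribˡ-* _ _ ⟩
    fromℤ -[1+ m ] * (n · 1#)     ∎
  fromℤ-* -[1+ m ] -[1+ n ] = begin
    (suc m ℕ.* suc n) · 1#               ≈⟨ ×1-homo-* (suc m) (suc n) ⟩
    (suc m · 1#) * (suc n · 1#)          ≈⟨ -‿involutive _ ⟨
    - - ((suc m · 1#) * (suc n · 1#))    ≈⟨ -‿cong (-‿distribʳ-* _ _) ⟩
    - ((suc m · 1#) * fromℤ -[1+ n ])    ≈⟨ -‿distribˡ-* _ _ ⟩
    fromℤ -[1+ m ] * fromℤ -[1+ n ]      ∎

  private
    homomorphism : ℤ.+-*-rawRing -Raw-AlmostCommutative⟶ fromCommutativeRing R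
    homomorphism = record
      { ⟦_⟧    = fromℤ
      ; +-homo = fromℤ-+
      ; *-homo = fromℤ-*
      ; -‿homo = fromℤ-neg
      ; 0-homo = refl
      ; 1-homo = refl
      }

    fromℤ-≟ : ∀ i j → Maybe (fromℤ i ≈ fromℤ j)
    fromℤ-≟ i j = Maybe.map (λ eq → reflexive (≡.cong fromℤ eq)) (dec⇒maybe (i ℤ.≟ j))

  open import Algebra.Solver.Ring _ _ homomorphism fromℤ-≟ public
    using (solve; _:+_; _:*_; _:-_; :-_; _:=_; con)

-- Powers, binomial coefficients and additivity of the Frobenius map

module Powers {c ℓ : Level} (R : CommutativeRing c ℓ) where
  open CommutativeRing R renaming (Carrier to F)
  open FieldNotions R
  open import Algebra.Properties.CommutativeSemiring.Exp commutativeSemiring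

  pow≡^ : ∀ x n → pow x n ≡ x ^ n
  pow≡^ x zero    = ≡.refl
  pow≡^ x (suc n) = ≡.cong (x *_) (pow≡^ x n)

  pow-cong : ∀ {x y} n → x ≈ y → pow x n ≈ pow y n
  pow-cong zero    x≈y = refl
  pow-cong (suc n) x≈y = *-cong x≈y (pow-cong n x≈y)

  pow-+ : ∀ x m n → pow x (m ℕ.+ n) ≈ pow x m * pow x n
  pow-+ x m n rewrite pow≡^ x (m ℕ.+ n) | pow≡^ x m | pow≡^ x n = ^-homo-* x m n

  pow-* : ∀ x m n → pow x (m ℕ.* n) ≈ pow (pow x m) n
  pow-* x m n rewrite pow≡^ x (m ℕ.* n) | pow≡^ x m | pow≡^ (x ^ m) n = sym (^-assocʳ x m n)

  pow-distrib : ∀ x y n → pow (x * y) n ≈ pow x n * pow y n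
  pow-distrib x y n rewrite pow≡^ (x * y) n | pow≡^ x n | pow≡^ y n = ^-distrib-* x y n

  pow-1# : ∀ n → pow 1# n ≈ 1#
  pow-1# zero    = refl
  pow-1# (suc n) = trans (*-identityˡ _) (pow-1# n)

  pow-comm : ∀ x m n → pow (pow x m) n ≈ pow (pow x n) m
  pow-comm x m n = trans (sym (pow-* x m n))
    (trans (reflexive (≡.cong (pow x) (ℕ.*-comm m n))) (pow-* x n m))

prime∤! : ∀ {p} → Prime p → ∀ k → k ℕ.< p → p ∤ k ℕ.!
prime∤! pr zero    _   p∣1 = contradiction (∣.∣1⇒≡1 p∣1) (ℕ.nonTrivial⇒≢1 {{prime⇒nonTrivial pr}})
prime∤! pr (suc k) k<p p∣k! with euclidsLemma (suc k) (k ℕ.!) pr p∣k!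
... | inj₁ p∣k = ∣.>⇒∤ k<p p∣k
... | inj₂ p∣k!′ = prime∤! pr k (ℕ.<-trans (ℕ.n<1+n k) k<p) p∣k!′

-- `p` divides `p! = C * k! * (p - k)!`, and neither factorial has the factor `p`, since `k` and
-- `p - k` are smaller than `p`.
prime∣C : ∀ {p} → Prime p → ∀ k → 0 ℕ.< k → k ℕ.< p → p ∣ p C k
prime∣C {p@(suc p-1)} pr k 0<k k<p
  with euclidsLemma (p C k) (k ℕ.! ℕ.* (p ℕ.∸ k) ℕ.!) pr
         (≡.subst (p ∣_) (≡.sym C*k![p-k]!) (∣.m∣m*n (p-1 ℕ.!)))
  where
  k≤p = ℕ.<⇒≤ k<p
  instance
    _ = ℕ._!*_!≢0 k (p ℕ.∸ k)
  C*k![p-k]! : (p C k) ℕ.* (k ℕ.! ℕ.* (p ℕ.∸ k) ℕ.!) ≡ p ℕ.!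
  C*k![p-k]! = ≡.trans (≡.cong (ℕ._* (k ℕ.! ℕ.* (p ℕ.∸ k) ℕ.!)) (nCk≡n!/k![n-k]! k≤p))
                       (m/n*n≡m (k![n∸k]!∣n! k≤p))
... | inj₁ p∣C = p∣C
... | inj₂ p∣k!*[p-k]! with euclidsLemma (k ℕ.!) ((p ℕ.∸ k) ℕ.!) pr p∣k!*[p-k]!
...   | inj₁ p∣k!     = contradiction p∣k! (prime∤! pr k k<p)
...   | inj₂ p∣[p-k]! = contradiction p∣[p-k]! (prime∤! pr (p ℕ.∸ k) (ℕ.∸-monoʳ-< 0<k (ℕ.<⇒≤ k<p)))

module PrimeCharacteristic {c ℓ : Level} (R : CommutativeRing c ℓ) where
  open CommutativeRing R renaming (Carrier to F)
  open FieldNotions R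
  open Powers R
  open import Algebra.Properties.Semiring.Mult semiring using (×-congʳ; ×-assocˡ; ×-assoc-*; ×-homo-1) renaming (_×_ to _·_)
  open import Algebra.Properties.Semiring.Sum semiring
  open import Algebra.Properties.CommutativeSemiring.Binomial commutativeSemiring
  open import Algebra.Properties.CommutativeSemiring.Exp commutativeSemiring
  open import Relation.Binary.Reasoning.Setoid setoid

  char∣⇒·≈0 : ∀ {p n} → p · 1# ≈ 0# → p ∣ n → ∀ x → n · x ≈ 0#
  char∣⇒·≈0 {p} p≈0 (divides m ≡.refl) x = begin
    (m ℕ.* p) · x        ≈⟨ ×-assocˡ x m p ⟨
    m · (p · x)          ≈⟨ ×-congʳ m (×-congʳ p (*-identityˡ x)) ⟨
    m · (p · (1# * x))   ≈⟨ ×-congʳ m (×-assoc-* p 1# x) ⟨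
    m · ((p · 1#) * x)   ≈⟨ ×-congʳ m (trans (*-congʳ p≈0) (zeroˡ x)) ⟩
    m · 0#               ≈⟨ sum-replicate m ⟨
    sum (replicate m 0#) ≈⟨ sum-replicate-zero m ⟩
    0#                   ∎

  -- Binomial theorem with the first and the last term split off; every coefficient in between is
  -- divisible by `p`.
  pow-prime-+ : ∀ {p} → Prime p → p · 1# ≈ 0# → ∀ x y → pow (x + y) p ≈ pow x p + pow y p
  pow-prime-+ {p@(suc p-1)} pr p≈0 x y
    rewrite pow≡^ (x + y) p | pow≡^ x p | pow≡^ y p = begin
    (x + y) ^ p                          ≈⟨ theorem p x y ⟩
    T Fin.zero + sum (λ i → T (Fin.suc i)) ≈⟨ +-congˡ (sum-init-last (λ i → T (Fin.suc i))) ⟩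
    T Fin.zero + (sum (λ i → T (Fin.suc (inject₁ i))) + T (Fin.suc (fromℕ p-1)))
      ≈⟨ +-cong first (+-cong (trans (sum-cong-≋ middle) (sum-replicate-zero p-1)) last-) ⟩
    y ^ p + (0# + x ^ p)                 ≈⟨ +-congˡ (+-identityˡ _) ⟩
    y ^ p + x ^ p                        ≈⟨ +-comm _ _ ⟩
    x ^ p + y ^ p                        ∎
    where
    T = binomialTerm x y p
    first : T Fin.zero ≈ y ^ p
    first = trans (×-homo-1 _) (*-identityˡ _)
    middle : ∀ (i : Fin p-1) → T (Fin.suc (inject₁ i)) ≈ 0#
    middle i = char∣⇒·≈0 p≈0
      (prime∣C pr (suc (toℕ (inject₁ i))) (ℕ.s≤s ℕ.z≤n)
        (ℕ.s≤s (≡.subst (ℕ._< p-1) (≡.sym (Fin.toℕ-inject₁ i)) (Fin.toℕ<n i)))) _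
    last- : T (Fin.suc (fromℕ p-1)) ≈ x ^ p
    last- rewrite Fin.toℕ-fromℕ p-1 | nCn≡1 p | ℕ.n∸n≡0 p-1 =
      trans (×-homo-1 _) (*-identityʳ _)

  pow-primePower-+ : ∀ {p} → Prime p → p · 1# ≈ 0# →
    ∀ k x y → pow (x + y) (p ℕ.^ k) ≈ pow x (p ℕ.^ k) + pow y (p ℕ.^ k)
  pow-primePower-+ pr p≈0 zero x y =
    trans (*-identityʳ _) (sym (+-cong (*-identityʳ _) (*-identityʳ _)))
  pow-primePower-+ {p} pr p≈0 (suc k) x y = begin
    pow (x + y) (p ℕ.* p ℕ.^ k)                             ≈⟨ pow-* _ p _ ⟩
    pow (pow (x + y) p) (p ℕ.^ k)                           ≈⟨ pow-cong (p ℕ.^ k) (pow-prime-+ pr p≈0 x y) ⟩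
    pow (pow x p + pow y p) (p ℕ.^ k)                       ≈⟨ pow-primePower-+ pr p≈0 k _ _ ⟩
    pow (pow x p) (p ℕ.^ k) + pow (pow y p) (p ℕ.^ k)       ≈⟨ +-cong (pow-* _ p _) (pow-* _ p _) ⟨
    pow x (p ℕ.* p ℕ.^ k) + pow y (p ℕ.* p ℕ.^ k)           ∎

-- Finite fields and the identity `x^n = x`

module FiniteField {c ℓ : Level} (R : CommutativeRing c ℓ)
  (isField : FieldNotions.IsField R) {n : ℕ} (card : FieldNotions.HasCardinality R n) where
  open CommutativeRing R renaming (Carrier to F)
  open FieldNotions R
  open Powers R
  open import Algebra.Properties.Semiring.Mult semiring using () renaming (_×_ to _·_)
  open import Algebra.Properties.CommutativeSemiring.Exp commutativeSemiring using (_^_)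
  open import Algebra.Properties.Ring ring using (+-cancelˡ; x[y-z]≈xy-xz)
    renaming (x∙y⁻¹≈ε⇒x≈y to x-y≈0⇒x≈y; x≈y⇒x∙y⁻¹≈ε to x≈y⇒x-y≈0)
  open import Relation.Binary.Reasoning.Setoid setoid
  import Algebra.Properties.CommutativeMonoid.Sum as Sum

  enum : Fin n → F
  enum = proj₁ card

  enum-injective : ∀ i j → enum i ≈ enum j → i ≡ j
  enum-injective = proj₁ (proj₂ card)

  index : F → Fin n
  index x = proj₁ (proj₂ (proj₂ card) x)

  enum-index : ∀ x → enum (index x) ≈ x
  enum-index x = proj₂ (proj₂ (proj₂ card) x)

  infix 4 _≟_
  _≟_ : ∀ x y → Dec (x ≈ y)
  x ≟ y with index x Fin.≟ index y
  ... | yes eq = yes (trans (sym (enum-index x)) (trans (reflexive (≡.cong enum eq)) (enum-index y)))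
  ... | no neq = no λ x≈y → neq (enum-injective _ _ (trans (enum-index x) (trans x≈y (sym (enum-index y)))))

  1≉0 : ¬ 1# ≈ 0#
  1≉0 1≈0 = proj₁ isField (sym 1≈0)

  inverse : ∀ x → ¬ x ≈ 0# → Σ F λ y → x * y ≈ 1#
  inverse = proj₂ isField

  xy≈0⇒y≈0 : ∀ {x y} → ¬ x ≈ 0# → x * y ≈ 0# → y ≈ 0#
  xy≈0⇒y≈0 {x} {y} x≉0 xy≈0 = begin
    y            ≈⟨ *-identityˡ y ⟨
    1# * y       ≈⟨ *-congʳ (trans (*-comm _ _) xz≈1) ⟨
    z * x * y    ≈⟨ *-assoc z x y ⟩
    z * (x * y)  ≈⟨ *-congˡ xy≈0 ⟩
    z * 0#       ≈⟨ zeroʳ z ⟩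
    0#           ∎
    where
    z = proj₁ (inverse x x≉0)
    xz≈1 = proj₂ (inverse x x≉0)

  xy≈0⇒x≈0 : ∀ {x y} → ¬ y ≈ 0# → x * y ≈ 0# → x ≈ 0#
  xy≈0⇒x≈0 y≉0 xy≈0 = xy≈0⇒y≈0 y≉0 (trans (*-comm _ _) xy≈0)

  *-≉0 : ∀ {x y} → ¬ x ≈ 0# → ¬ y ≈ 0# → ¬ x * y ≈ 0#
  *-≉0 x≉0 y≉0 xy≈0 = y≉0 (xy≈0⇒y≈0 x≉0 xy≈0)

  *-cancelˡ : ∀ {x y z} → ¬ x ≈ 0# → x * y ≈ x * z → y ≈ z
  *-cancelˡ {x} {y} {z} x≉0 eq = x-y≈0⇒x≈y y z
    (xy≈0⇒y≈0 x≉0 (trans (x[y-z]≈xy-xz x y z) (x≈y⇒x-y≈0 eq)))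

  *-cancelʳ : ∀ {x y z} → ¬ x ≈ 0# → y * x ≈ z * x → y ≈ z
  *-cancelʳ x≉0 eq = *-cancelˡ x≉0 (trans (*-comm _ _) (trans eq (*-comm _ _)))

  pow-≉0 : ∀ {x} k → ¬ x ≈ 0# → ¬ pow x k ≈ 0#
  pow-≉0 zero    x≉0 = 1≉0
  pow-≉0 (suc k) x≉0 = *-≉0 x≉0 (pow-≉0 k x≉0)

  private
    -- Sums and products over `enum` are invariant under permutations of the indices; this moves a
    -- bijection of the field to the indices.
    bijection⇒permutation : (f g : F → F) →
      (∀ {x y} → x ≈ y → f x ≈ f y) → (∀ {x y} → x ≈ y → g x ≈ g y) →
      (∀ x → f (g x) ≈ x) → (∀ x → g (f x) ≈ x) → Permutation n n
    bijection⇒permutation f g f-cong g-cong fg gf =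
      permutation (λ i → index (f (enum i))) (λ i → index (g (enum i)))
        (λ i → enum-injective _ _ (trans (enum-index _) (trans (f-cong (enum-index _)) (fg (enum i)))))
        (λ i → enum-injective _ _ (trans (enum-index _) (trans (g-cong (enum-index _)) (gf (enum i)))))

  -- Translation by 1 permutes the field, so the sum of all elements is unchanged when 1 is added to
  -- each of the `n` summands.
  cardinality-·-1 : n · 1# ≈ 0#
  cardinality-·-1 = +-cancelˡ (sum enum) _ _ $ begin
    sum enum + n · 1#                   ≈⟨ +-congˡ (sum-replicate n) ⟨
    sum enum + sum (replicate n 1#)     ≈⟨ ∑-distrib-+ enum (replicate n 1#) ⟨
    sum (λ i → enum i + 1#)             ≈⟨ sum-cong-≋ (λ i → enum-index (enum i + 1#)) ⟨
    sum (λ i → enum (π ⟨$⟩ʳ i))         ≈⟨ sum-permute enum π ⟨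
    sum enum                            ≈⟨ +-identityʳ _ ⟨
    sum enum + 0#                       ∎
    where
    open Sum +-commutativeMonoid
    π = bijection⇒permutation (_+ 1#) (_- 1#) +-congʳ +-congʳ
      (λ x → trans (+-assoc _ _ _) (trans (+-congˡ (-‿inverseˡ 1#)) (+-identityʳ x)))
      (λ x → trans (+-assoc _ _ _) (trans (+-congˡ (-‿inverseʳ 1#)) (+-identityʳ x)))

  private
    -- Putting 1 at the zero element turns a product over the nonzero elements into one over the
    -- whole enumeration.
    nonzeroOr1 : F → F → F
    nonzeroOr1 z y with y ≟ 0#
    ... | yes _ = 1#
    ... | no  _ = z

    nonzeroOr1-≈0 : ∀ z {y} → y ≈ 0# → nonzeroOr1 z y ≈ 1#
    nonzeroOr1-≈0 z {y} y≈0 with y ≟ 0#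
    ... | yes _  = refl
    ... | no y≉0 = contradiction y≈0 y≉0

    nonzeroOr1-≉0 : ∀ z {y} → ¬ y ≈ 0# → nonzeroOr1 z y ≈ z
    nonzeroOr1-≉0 z {y} y≉0 with y ≟ 0#
    ... | yes y≈0 = contradiction y≈0 y≉0
    ... | no _    = refl

  -- Multiplication by x ≠ 0 permutes the nonzero elements, so it does not change their product.
  pow-cardinality : ∀ x → pow x n ≈ x
  pow-cardinality x with x ≟ 0#
  ... | yes x≈0 = pow-0 n (index 0#)
    where
    -- The index witnesses that the exponent is positive; with exponent 0 the power of zero would be
    -- 1.
    pow-0 : ∀ m → Fin m → pow x m ≈ x
    pow-0 (suc m) _ = trans (*-congʳ x≈0) (trans (zeroˡ _) (sym x≈0))
  ... | no x≉0 = lemma n enum ≡.refl (index 0#) (enum-index 0#) enum-injective (*-cancelʳ ∏≉0 (begin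
      ∏ (λ i → h (enum i)) * ∏ (λ i → id₁ (enum i)) ≈⟨ ∑-distrib-+ (λ i → h (enum i)) (λ i → id₁ (enum i)) ⟨
      ∏ (λ i → h (enum i) * id₁ (enum i))           ≈⟨ sum-cong-≋ (λ i → shift (enum i)) ⟨
      ∏ (λ i → id₁ (enum (π ⟨$⟩ʳ i)))               ≈⟨ sum-permute (λ i → id₁ (enum i)) π ⟨
      ∏ (λ i → id₁ (enum i))                        ≈⟨ *-identityˡ _ ⟨
      1# * ∏ (λ i → id₁ (enum i))                   ∎))
    where
    open Sum *-commutativeMonoid renaming (sum to ∏)
    x⁻¹ = proj₁ (inverse x x≉0)
    xx⁻¹≈1 = proj₂ (inverse x x≉0)
    π = bijection⇒permutation (x *_) (x⁻¹ *_) *-congˡ *-congˡ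
      (λ y → trans (sym (*-assoc _ _ _)) (trans (*-congʳ xx⁻¹≈1) (*-identityˡ y)))
      (λ y → trans (sym (*-assoc _ _ _)) (trans (*-congʳ (trans (*-comm _ _) xx⁻¹≈1)) (*-identityˡ y)))
    h id₁ : F → F
    h = nonzeroOr1 x
    id₁ y = nonzeroOr1 y y
    ∏≉0 : ¬ ∏ (λ i → id₁ (enum i)) ≈ 0#
    ∏≉0 = all≉0 _ λ i → id₁≉0 (enum i)
      where
      id₁≉0 : ∀ y → ¬ id₁ y ≈ 0#
      id₁≉0 y with y ≟ 0#
      ... | yes _  = 1≉0
      ... | no y≉0 = y≉0
      all≉0 : ∀ {m} (v : Vector F m) → (∀ i → ¬ v i ≈ 0#) → ¬ ∏ v ≈ 0#
      all≉0 {zero}  v v≉0 = 1≉0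
      all≉0 {suc m} v v≉0 = *-≉0 (v≉0 Fin.zero) (all≉0 _ (v≉0 ∘ Fin.suc))
    shift : ∀ y → id₁ (enum (index (x * y))) ≈ h y * id₁ y
    shift y with y ≟ 0#
    ... | yes y≈0 = trans (nonzeroOr1-≈0 _ (trans (enum-index _) (trans (*-congˡ y≈0) (zeroʳ x)))) (sym (*-identityˡ 1#))
    ... | no y≉0  = trans (nonzeroOr1-≉0 _ (λ eq → *-≉0 x≉0 y≉0 (trans (sym (enum-index _)) eq))) (enum-index (x * y))
    -- The product of the values of `h` has the factor 1 at the index of zero and the factor `x`
    -- elsewhere, so it is `x^(m - 1)`. The length is a variable `m` so that it can be split as a
    -- successor.
    lemma : ∀ m (v : Fin m → F) → m ≡ n → (i₀ : Fin m) → v i₀ ≈ 0# → (∀ i j → v i ≈ v j → i ≡ j) →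
      ∏ (λ i → h (v i)) ≈ 1# → pow x m ≈ x
    lemma (suc m) v _ i₀ vi₀≈0 v-inj ∏h≈1 = trans (*-congˡ (begin
      pow x m                                  ≡⟨ pow≡^ x m ⟩
      x ^ m                                    ≈⟨ sum-replicate m ⟨
      ∏ (replicate m x)                        ≈⟨ sum-cong-≋ (λ j → nonzeroOr1-≉0 x (λ eq →
                                                    Fin.punchInᵢ≢i i₀ j (v-inj _ _ (trans eq (sym vi₀≈0))))) ⟨
      ∏ (removeAt (λ i → h (v i)) i₀)          ≈⟨ *-identityˡ _ ⟨
      1# * ∏ (removeAt (λ i → h (v i)) i₀)     ≈⟨ *-congʳ (nonzeroOr1-≈0 x vi₀≈0) ⟨
      h (v i₀) * ∏ (removeAt (λ i → h (v i)) i₀) ≈⟨ sum-remove (λ i → h (v i)) ⟨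
      ∏ (λ i → h (v i))                        ≈⟨ ∏h≈1 ⟩
      1#                                       ∎)) (*-identityʳ x)

-- Counting roots of monic polynomials

module Roots {c ℓ : Level} (R : CommutativeRing c ℓ)
  (isField : FieldNotions.IsField R) {n : ℕ} (card : FieldNotions.HasCardinality R n) where
  open CommutativeRing R renaming (Carrier to F)
  open FieldNotions R
  open Powers R
  open FiniteField R isField card
  open IntegerSolver R
  open import Algebra.Properties.Ring ring
    renaming (x∙y⁻¹≈ε⇒x≈y to x-y≈0⇒x≈y; x≈y⇒x∙y⁻¹≈ε to x≈y⇒x-y≈0) using ()
  open import Relation.Binary.Reasoning.Setoid setoid

  Distinct : List F → Set (c ⊔ ℓ)
  Distinct = AllPairs (λ x y → ¬ x ≈ y)

  -- Stated through duplicate-free lists, so that a subset can be bounded without being enumerated.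
  AtMost : ℕ → (F → Set ℓ) → Set (c ⊔ ℓ)
  AtMost d P = ∀ xs → Distinct xs → All P xs → length xs ℕ.≤ d

  atMost-⊎ : ∀ {k l} {P Q : F → Set ℓ} → AtMost k P → AtMost l Q → AtMost (k ℕ.+ l) (λ x → P x ⊎ Q x)
  atMost-⊎ {k} {l} {P} {Q} P≤k Q≤l xs distinct all with split xs distinct all
    where
    -- The last component transfers any predicate from `xs` to both sublists; applied to being
    -- different from `x`, it keeps the sublists distinct when `x` is added.
    split : ∀ xs → Distinct xs → All (λ x → P x ⊎ Q x) xs → Σ (List F) λ ys → Σ (List F) λ zs →
      Distinct ys × All P ys × Distinct zs × All Q zs × length xs ≡ length ys ℕ.+ length zs ×
      (∀ {S : F → Set ℓ} → All S xs → All S ys × All S zs)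
    split [] [] [] = [] , [] , [] , [] , [] , [] , ≡.refl , λ _ → [] , []
    split (x ∷ xs) (x≉ ∷ distinct) (p ∷ ps) with split xs distinct ps
    ... | ys , zs , dys , Pys , dzs , Qzs , len , sub with p
    ...   | inj₁ Px = x ∷ ys , zs , proj₁ (sub x≉) ∷ dys , Px ∷ Pys , dzs , Qzs , ≡.cong suc len ,
                      λ { (s ∷ ss) → s ∷ proj₁ (sub ss) , proj₂ (sub ss) }
    ...   | inj₂ Qx = ys , x ∷ zs , dys , Pys , proj₂ (sub x≉) ∷ dzs , Qx ∷ Qzs ,
                      ≡.trans (≡.cong suc len) (≡.sym (ℕ.+-suc _ _)) ,
                      λ { (s ∷ ss) → proj₁ (sub ss) , s ∷ proj₂ (sub ss) }
  ... | ys , zs , dys , Pys , dzs , Qzs , len , _ =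
    ≡.subst (ℕ._≤ k ℕ.+ l) (≡.sym len) (ℕ.+-mono-≤ (P≤k ys dys Pys) (Q≤l zs dzs Qzs))

  -- Pigeonhole: the enumeration is itself a distinct list, of length `n`. The elements chosen in
  -- `separate`, `parameter` and `∃V` come from here.
  atMost⇒∃¬ : ∀ {k} {P : F → Set ℓ} → Decidable P → AtMost k P → k ℕ.< n → ∃ λ x → ¬ P x
  atMost⇒∃¬ {k} {P} P? P≤k k<n with All.all? P? (tabulate enum)
  ... | no ¬all = Any.satisfied (¬All⇒Any¬ P? (tabulate enum) ¬all)
  ... | yes all = contradiction k<n (ℕ.≤⇒≯ (≡.subst (ℕ._≤ k) (length-tabulate enum)
    (P≤k (tabulate enum) (AllPairs.tabulate⁺ (λ i≢j eq → i≢j (enum-injective _ _ eq))) all)))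

  -- Polynomial functions in Horner form, indexed by the degree; this shape makes division by
  -- `x - r` a structural recursion.
  data Monic : ℕ → (F → F) → Set (c ⊔ ℓ) where
    one  : ∀ {f} → (∀ x → f x ≈ 1#) → Monic 0 f
    step : ∀ {d f g} → Monic d g → ∀ a → (∀ x → f x ≈ x * g x + a) → Monic (suc d) f

  -- Synthetic division: at each Horner step the remainder `g r` of the inner polynomial becomes the
  -- constant coefficient of the quotient.
  monic-divide : ∀ {d f} → Monic (suc d) f → ∀ r →
    Σ (F → F) λ g → Monic d g × (∀ x → f x ≈ (x - r) * g x + f r)
  monic-divide {zero} {f} (step {g = g} (one g≈1) a f≈) r = g , one g≈1 , λ x → begin
    f x                              ≈⟨ f≈ x ⟩
    x * g x + a                      ≈⟨ +-congʳ (*-congˡ (g≈1 x)) ⟩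
    x * 1# + a                       ≈⟨ solve 3 (λ x r a → x :* con 1ℤ :+ a := (x :- r) :* con 1ℤ :+ (r :* con 1ℤ :+ a)) refl x r a ⟩
    (x - r) * 1# + (r * 1# + a)      ≈⟨ +-cong (*-congˡ (g≈1 x)) (+-congʳ (*-congˡ (g≈1 r))) ⟨
    (x - r) * g x + (r * g r + a)    ≈⟨ +-congˡ (f≈ r) ⟨
    (x - r) * g x + f r              ∎
  monic-divide {suc d} {f} (step {g = g} monic a f≈) r with monic-divide monic r
  ... | h , h-monic , g≈ = (λ x → x * h x + g r) , step h-monic (g r) (λ _ → refl) , λ x → begin
    f x                                              ≈⟨ f≈ x ⟩
    x * g x + a                                      ≈⟨ +-congʳ (*-congˡ (g≈ x)) ⟩
    x * ((x - r) * h x + g r) + a                    ≈⟨ solve 5 (λ x r h g a →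
                                                          x :* ((x :- r) :* h :+ g) :+ a :=
                                                          (x :- r) :* (x :* h :+ g) :+ (r :* g :+ a)) refl x r (h x) (g r) a ⟩
    (x - r) * (x * h x + g r) + (r * g r + a)        ≈⟨ +-congˡ (f≈ r) ⟨
    (x - r) * (x * h x + g r) + f r                  ∎

  -- After division by `x - r` at a root `r`, the remaining roots differ from `r` and hence are
  -- roots of the quotient, whose degree is one less.
  monic-roots : ∀ {d f} → Monic d f → AtMost d (λ x → f x ≈ 0#)
  monic-roots monic [] _ _ = ℕ.z≤n
  monic-roots (one f≈1) (x ∷ _) _ (fx≈0 ∷ _) = contradiction (trans (sym (f≈1 x)) fx≈0) 1≉0
  monic-roots {suc d} {f} monic@(step _ _ _) (r ∷ xs) (r≉ ∷ distinct) (fr≈0 ∷ fxs≈0)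
    with monic-divide monic r
  ... | g , g-monic , f≈ = ℕ.s≤s (monic-roots g-monic xs distinct
        (All.zipWith (λ { (r≉x , fx≈0) → g≈0 r≉x fx≈0 }) (r≉ , fxs≈0)))
    where
    g≈0 : ∀ {x} → ¬ r ≈ x → f x ≈ 0# → g x ≈ 0#
    g≈0 {x} r≉x fx≈0 = xy≈0⇒y≈0 (λ eq → r≉x (sym (x-y≈0⇒x≈y x r eq))) (begin
      (x - r) * g x        ≈⟨ +-identityʳ _ ⟨
      (x - r) * g x + 0#   ≈⟨ +-congˡ fr≈0 ⟨
      (x - r) * g x + f r  ≈⟨ f≈ x ⟨
      f x                  ≈⟨ fx≈0 ⟩
      0#                   ∎)

  pow-monic : ∀ k → Monic k (λ x → pow x k)
  pow-monic zero    = one λ _ → refl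
  pow-monic (suc k) = step (pow-monic k) 0# λ _ → sym (+-identityʳ _)

  atMost-pow : ∀ k .{{_ : ℕ.NonZero k}} a → AtMost k (λ x → pow x k ≈ a)
  atMost-pow (suc k) a xs distinct all =
    monic-roots {f = λ x → pow x (suc k) - a} (step (pow-monic k) (- a) (λ _ → refl)) xs distinct
      (All.map x≈y⇒x-y≈0 all)

  atMost-≈0 : AtMost 1 (_≈ 0#)
  atMost-≈0 []          _ _ = ℕ.z≤n
  atMost-≈0 (_ ∷ [])    _ _ = ℕ.s≤s ℕ.z≤n
  atMost-≈0 (_ ∷ _ ∷ _) ((x≉y ∷ _) ∷ _) (x≈0 ∷ y≈0 ∷ _) = contradiction (trans x≈0 (sym y≈0)) x≉y

-- Arithmetic of the exponents and the estimates for the root count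

^-double : ∀ q t → q ℕ.^ (2 ℕ.* t) ≡ q ℕ.^ t ℕ.* q ℕ.^ t
^-double q t = ≡.trans (≡.cong (λ k → q ℕ.^ (t ℕ.+ k)) (ℕ.+-identityʳ t)) (ℕ.^-distribˡ-+-* q t t)

1+[2+a]*a : ∀ a → suc (suc (suc a) ℕ.* a) ≡ suc a ℕ.* suc a
1+[2+a]*a = solve-∀

[1+q^t]*[q^t-1] : ∀ q .{{_ : ℕ.NonZero q}} t → suc (suc (q ℕ.^ t) ℕ.* ℕ.pred (q ℕ.^ t)) ≡ q ℕ.^ (2 ℕ.* t)
[1+q^t]*[q^t-1] q t = ≡.trans (≡.cong (λ k → suc (suc k ℕ.* Q⁻)) (≡.sym suc-Q⁻))
  (≡.trans (1+[2+a]*a Q⁻) (≡.trans (≡.cong₂ ℕ._*_ suc-Q⁻ suc-Q⁻) (≡.sym (^-double q t))))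
  where
  Q⁻ = ℕ.pred (q ℕ.^ t)
  suc-Q⁻ = ℕ.suc-pred (q ℕ.^ t) {{ℕ.m^n≢0 q t}}

-- Subtraction-free form of `(q - 1) E = q^n - 1`, where `E` is `normExp q n`.
normExp-step : ∀ q n → q ℕ.* normExp q n ℕ.+ 1 ≡ q ℕ.^ n ℕ.+ normExp q n
normExp-step q zero    = ≡.cong (ℕ._+ 1) (ℕ.*-zeroʳ q)
normExp-step q (suc n) = begin
  q ℕ.* (q ℕ.^ n ℕ.+ normExp q n) ℕ.+ 1         ≡⟨ ≡.cong (ℕ._+ 1) (ℕ.*-distribˡ-+ q (q ℕ.^ n) _) ⟩
  q ℕ.^ suc n ℕ.+ q ℕ.* normExp q n ℕ.+ 1       ≡⟨ ℕ.+-assoc (q ℕ.^ suc n) _ 1 ⟩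
  q ℕ.^ suc n ℕ.+ (q ℕ.* normExp q n ℕ.+ 1)     ≡⟨ ≡.cong (q ℕ.^ suc n ℕ.+_) (normExp-step q n) ⟩
  q ℕ.^ suc n ℕ.+ (q ℕ.^ n ℕ.+ normExp q n)     ∎
  where open ≡.≡-Reasoning

primePower>1 : ∀ {q} → IsPrimePower q → 1 ℕ.< q
primePower>1 (p , suc k , pr , _ , ≡.refl) = ℕ.≤-trans (ℕ.nonTrivial⇒n>1 p {{prime⇒nonTrivial pr}})
  (ℕ.m≤m*n p (p ℕ.^ k) {{ℕ.m^n≢0 p k {{prime⇒nonZero pr}}}})

normExp>0 : ∀ q .{{_ : ℕ.NonZero q}} n → 0 ℕ.< n → 0 ℕ.< normExp q n
normExp>0 q (suc n) _ = ℕ.≤-trans (ℕ.m^n>0 q n) (ℕ.m≤m+n (q ℕ.^ n) (normExp q n))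

coprime⇒∤ : ∀ {s n d} → gcd s n ≡ 1 → d ∣ n → 1 ℕ.< d → ¬ d ∣ s
coprime⇒∤ {s} {n} {d} coprime d∣n 1<d d∣s =
  ℕ.<⇒≢ 1<d (≡.sym (∣.∣1⇒≡1 (≡.subst (d ∣_) coprime (gcd-greatest d∣s d∣n))))

normExp-geometric : ∀ p n → p ℕ.* normExp (suc p) n ℕ.+ 1 ≡ suc p ℕ.^ n
normExp-geometric p n = ℕ.+-cancelˡ-≡ e _ _ (≡.trans (≡.sym (ℕ.+-assoc e (p ℕ.* e) 1))
  (≡.trans (normExp-step (suc p) n) (ℕ.+-comm (suc p ℕ.^ n) e)))
  where e = normExp (suc p) n

pred-^ : ∀ p n → ℕ.pred (suc p ℕ.^ n) ≡ p ℕ.* normExp (suc p) n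
pred-^ p n = ≡.cong ℕ.pred (≡.trans (≡.sym (normExp-geometric p n)) (ℕ.+-comm (p ℕ.* normExp (suc p) n) 1))

-- If m = yȳ, where y avoids the roots of X, X^(2E) - 1 and X^((qᵗ + 1)A) - (-1)ʲ, then m is not of the form b^(q + 1) with b̄ = -b.
Exponents : ℕ → ℕ → Set
Exponents q t = Σ ℕ λ A → Σ ℕ λ j → 0 ℕ.< A × suc q ℕ.* A ≡ ℕ.pred (q ℕ.^ t) ℕ.* j ×
  suc (normExp q (2 ℕ.* t) ℕ.+ normExp q (2 ℕ.* t) ℕ.+ suc (q ℕ.^ t) ℕ.* A) ℕ.< q ℕ.^ (2 ℕ.* t)

-- With the odd number `q` written as `1 + l * 2`, the difference `q - 1` is a plain product.
module _ (l t : ℕ) (0<t : 0 ℕ.< t) where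
  private
    q E Q⁻ M : ℕ
    q = suc (l ℕ.* 2)
    E = normExp q (2 ℕ.* t)
    Q⁻ = ℕ.pred (q ℕ.^ t)
    M = suc (q ℕ.^ t) ℕ.* Q⁻

    suc-M : suc M ≡ q ℕ.^ (2 ℕ.* t)
    suc-M = [1+q^t]*[q^t-1] q t

    -- `M` is `q^(2t) - 1`, which equals `(q - 1) E`.
    E-bound : ∀ k → k ℕ.≤ l ℕ.* 2 → k ℕ.* E ℕ.≤ M
    E-bound k k≤ = ℕ.≤-trans (ℕ.*-monoˡ-≤ E k≤) (ℕ.≤-reflexive
      (≡.trans (≡.sym (pred-^ (l ℕ.* 2) (2 ℕ.* t))) (≡.cong ℕ.pred (≡.sym suc-M))))

    -- In fractions: `2E ≤ (u/k) M` and `B ≤ (v/k) M` with `u/k + v/k < 1` give `2E + B < M`.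
    -- Multiplying by `k` keeps the estimate within the natural numbers.
    bound : ∀ k u v {B} → 0 ℕ.< M → u ℕ.+ v ℕ.< k → k ℕ.* (E ℕ.+ E) ℕ.≤ u ℕ.* M → k ℕ.* B ℕ.≤ v ℕ.* M →
      suc (E ℕ.+ E ℕ.+ B) ℕ.< q ℕ.^ (2 ℕ.* t)
    bound k u v {B} 0<M u+v<k E≤ B≤ = ≡.subst (suc (E ℕ.+ E ℕ.+ B) ℕ.<_) suc-M (ℕ.s<s (ℕ.*-cancelˡ-< k _ _ (begin-strict
      k ℕ.* (E ℕ.+ E ℕ.+ B)              ≡⟨ ℕ.*-distribˡ-+ k (E ℕ.+ E) B ⟩
      k ℕ.* (E ℕ.+ E) ℕ.+ k ℕ.* B        ≤⟨ ℕ.+-mono-≤ E≤ B≤ ⟩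
      u ℕ.* M ℕ.+ v ℕ.* M                ≡⟨ ℕ.*-distribʳ-+ M u v ⟨
      (u ℕ.+ v) ℕ.* M                    <⟨ ℕ.*-monoˡ-< M {{ℕ.>-nonZero 0<M}} u+v<k ⟩
      k ℕ.* M                            ∎)))
      where open ℕ.≤-Reasoning

    M>0 : 0 ℕ.< l → 0 ℕ.< M
    M>0 0<l = ≡.subst (λ k → 0 ℕ.< suc (q ℕ.^ t) ℕ.* k) (≡.sym (pred-^ (l ℕ.* 2) t))
      (ℕ.≤-trans (ℕ.*-mono-≤ {1} (ℕ.*-mono-≤ {1} 0<l (ℕ.s≤s (ℕ.z≤n {1}))) (normExp>0 q t 0<t)) (ℕ.m≤m+n _ _))

    double : ∀ c {x y} → x ℕ.≤ y → c ℕ.* x ℕ.≤ c ℕ.* y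
    double c = ℕ.*-monoʳ-≤ c

  -- Here A = (qᵗ - 1)/(q + 1).
  exponents-even : ∀ h → t ≡ h ℕ.* 2 → 2 ℕ.≤ l → Exponents q t
  exponents-even h t≡ 2≤l = A , 1 , 0<A , ≡.trans [q+1]A≡Q⁻ (≡.sym (ℕ.*-identityʳ Q⁻)) ,
    -- Here `q ≥ 5`, so `4E ≤ M` gives `2E ≤ M/2`, and `B = M/(q + 1) ≤ M/6`; the common denominator
    -- is 12.
    bound 12 6 2 (M>0 0<l) (ℕ.m<m+n 8 ℕ.z<s)
      (≡.subst₂ ℕ._≤_ (rearrange E) (≡.refl {x = 6 ℕ.* M}) (double 6 (E-bound 4 (ℕ.*-monoˡ-≤ 2 2≤l))))
      (≡.subst (ℕ._≤ 2 ℕ.* M) (rearrange′ B) (double 2 (ℕ.≤-trans (ℕ.*-monoˡ-≤ B 6≤q+1) (ℕ.≤-reflexive [q+1]B≡M))))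
    where
    0<l = ℕ.≤-trans (ℕ.s≤s ℕ.z≤n) 2≤l
    -- Since `t = 2h`, this is `(q^t - 1)/(q^2 - 1)`, and the factor `q - 1` in `A` leaves the
    -- denominator `q + 1`.
    G = normExp (q ℕ.* q) h
    A = l ℕ.* 2 ℕ.* G
    B = suc (q ℕ.^ t) ℕ.* A
    0<h : 0 ℕ.< h
    0<h = ℕ.n≢0⇒n>0 λ { ≡.refl → ℕ.<⇒≢ 0<t (≡.sym t≡) }
    0<A : 0 ℕ.< A
    0<A = ℕ.*-mono-≤ {1} (ℕ.*-mono-≤ {1} 0<l (ℕ.s≤s (ℕ.z≤n {1}))) (normExp>0 (q ℕ.* q) h 0<h)
    [q+1]A≡Q⁻ : suc q ℕ.* A ≡ Q⁻
    [q+1]A≡Q⁻ = begin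
      suc q ℕ.* (l ℕ.* 2 ℕ.* G)                        ≡⟨ ℕ.*-assoc (suc q) (l ℕ.* 2) G ⟨
      suc q ℕ.* (l ℕ.* 2) ℕ.* G                        ≡⟨ ≡.cong (λ k → suc q ℕ.* (l ℕ.* 2) ℕ.* normExp k h) (1+[2+a]*a (l ℕ.* 2)) ⟨
      suc q ℕ.* (l ℕ.* 2) ℕ.* normExp (suc (suc q ℕ.* (l ℕ.* 2))) h ≡⟨ pred-^ (suc q ℕ.* (l ℕ.* 2)) h ⟨
      ℕ.pred (suc (suc q ℕ.* (l ℕ.* 2)) ℕ.^ h)         ≡⟨ ≡.cong (λ k → ℕ.pred (k ℕ.^ h)) (1+[2+a]*a (l ℕ.* 2)) ⟩
      ℕ.pred ((q ℕ.* q) ℕ.^ h)                         ≡⟨ ≡.cong (λ k → ℕ.pred (k ℕ.^ h)) (≡.cong (q ℕ.*_) (≡.sym (ℕ.*-identityʳ q))) ⟩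
      ℕ.pred ((q ℕ.^ 2) ℕ.^ h)                         ≡⟨ ≡.cong ℕ.pred (ℕ.^-*-assoc q 2 h) ⟩
      ℕ.pred (q ℕ.^ (2 ℕ.* h))                         ≡⟨ ≡.cong (λ k → ℕ.pred (q ℕ.^ k)) (≡.trans (ℕ.*-comm 2 h) (≡.sym t≡)) ⟩
      Q⁻                                               ∎
      where open ≡.≡-Reasoning
    [q+1]B≡M : suc q ℕ.* B ≡ M
    [q+1]B≡M = ≡.trans (swap (suc q) (suc (q ℕ.^ t)) A) (≡.cong (suc (q ℕ.^ t) ℕ.*_) [q+1]A≡Q⁻)
      where
      swap : ∀ a b c → a ℕ.* (b ℕ.* c) ≡ b ℕ.* (a ℕ.* c)
      swap = solve-∀
    6≤q+1 : 6 ℕ.≤ suc q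
    6≤q+1 = ℕ.s≤s (ℕ.s≤s (ℕ.*-monoˡ-≤ 2 2≤l))
    rearrange : ∀ e → 6 ℕ.* (4 ℕ.* e) ≡ 12 ℕ.* (e ℕ.+ e)
    rearrange = solve-∀
    rearrange′ : ∀ b → 2 ℕ.* (6 ℕ.* b) ≡ 12 ℕ.* b
    rearrange′ = solve-∀

  -- Here A = (qᵗ - 1)/2.
  exponents-odd : 3 ℕ.≤ l → Exponents q t
  -- The exponent of the sign is `l + 1 = (q + 1)/2`, because `(q + 1) A = (q^t - 1)(q + 1)/2`.
  exponents-odd 3≤l = A , suc l , 0<A , [q+1]A≡ ,
    -- Here `q ≥ 7`, so `6E ≤ M` gives `2E ≤ M/3`, and `B = M/2`; the common denominator is 6.
    bound 6 2 3 (M>0 0<l) (ℕ.n<1+n 5)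
      (≡.subst₂ ℕ._≤_ (rearrange E) (≡.refl {x = 2 ℕ.* M}) (double 2 (E-bound 6 (ℕ.*-monoˡ-≤ 2 3≤l))))
      (≡.subst (ℕ._≤ 3 ℕ.* M) (rearrange′ B) (double 3 (ℕ.≤-reflexive 2B≡M)))
    where
    0<l = ℕ.≤-trans (ℕ.s≤s ℕ.z≤n) 3≤l
    A = l ℕ.* normExp q t
    B = suc (q ℕ.^ t) ℕ.* A
    0<A : 0 ℕ.< A
    0<A = ℕ.*-mono-≤ {1} 0<l (normExp>0 q t 0<t)
    2A≡Q⁻ : 2 ℕ.* A ≡ Q⁻
    2A≡Q⁻ = ≡.trans (≡.trans (≡.sym (ℕ.*-assoc 2 l _)) (≡.cong (ℕ._* normExp q t) (ℕ.*-comm 2 l))) (≡.sym (pred-^ (l ℕ.* 2) t))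
    [q+1]A≡ : suc q ℕ.* A ≡ Q⁻ ℕ.* suc l
    [q+1]A≡ = ≡.trans (factor l A) (≡.cong (ℕ._* suc l) 2A≡Q⁻)
      where
      factor : ∀ l a → suc (suc (l ℕ.* 2)) ℕ.* a ≡ 2 ℕ.* a ℕ.* suc l
      factor = solve-∀
    2B≡M : 2 ℕ.* B ≡ M
    2B≡M = ≡.trans (swap (suc (q ℕ.^ t)) A) (≡.cong (suc (q ℕ.^ t) ℕ.*_) 2A≡Q⁻)
      where
      swap : ∀ b c → 2 ℕ.* (b ℕ.* c) ≡ b ℕ.* (2 ℕ.* c)
      swap = solve-∀
    rearrange : ∀ e → 2 ℕ.* (6 ℕ.* e) ≡ 6 ℕ.* (e ℕ.+ e)
    rearrange = solve-∀
    rearrange′ : ∀ b → 3 ℕ.* (2 ℕ.* b) ≡ 6 ℕ.* b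
    rearrange′ = solve-∀

  exponents : (t % 2 ≡ 0 × 3 ℕ.< q) ⊎ (t % 2 ≡ 1 × 5 ℕ.< q) → Exponents q t
  exponents (inj₁ (even , 3<q)) = exponents-even (t / 2)
    (≡.trans (m≡m%n+[m/n]*n t 2) (≡.cong (ℕ._+ t / 2 ℕ.* 2) even))
    (ℕ.*-cancelʳ-< 2 1 l (ℕ.s<s⁻¹ 3<q))
  exponents (inj₂ (_ , 5<q)) = exponents-odd (ℕ.*-cancelʳ-< 2 2 l (ℕ.s<s⁻¹ 5<q))

-- The field `F`, its Frobenius powers, conjugation and norm

module QuadraticExtension {c ℓ : Level} (R : CommutativeRing c ℓ) (isField : FieldNotions.IsField R)
  {q t : ℕ} (primePower : IsPrimePower q) (odd : IsOdd q) (4<t : 4 ℕ.< t)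
  (card : FieldNotions.HasCardinality R (q ℕ.^ (2 ℕ.* t))) where
  open CommutativeRing R renaming (Carrier to F)
  open FieldNotions R
  open Powers R
  open FiniteField R isField card
  open Roots R isField card
  open PrimeCharacteristic R
  open IntegerSolver R
  open import Algebra.Properties.Semiring.Mult semiring using (×1-homo-*; ×-homo-+) renaming (_×_ to _·_)
  open import Algebra.Properties.Ring ring
    using (-0#≈0#; x[y-z]≈xy-xz; -‿distribˡ-*; -‿distribʳ-*; +-cancelˡ; +-inverseˡ-unique)
    renaming (x∙y⁻¹≈ε⇒x≈y to x-y≈0⇒x≈y; x≈y⇒x∙y⁻¹≈ε to x≈y⇒x-y≈0)
  open import Relation.Binary.Reasoning.Setoid setoid

  0<t : 0 ℕ.< t
  0<t = ℕ.<-trans ℕ.z<s 4<t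

  ^-·-1 : ∀ m k → (m ℕ.^ k) · 1# ≈ pow (m · 1#) k
  ^-·-1 m zero    = +-identityʳ 1#
  ^-·-1 m (suc k) = trans (×1-homo-* m (m ℕ.^ k)) (*-congˡ (^-·-1 m k))

  -- A field has no nilpotents. This descends from the cardinality to `q`, and from `q` to the prime
  -- `p`.
  ^-·-1≈0 : ∀ m k → (m ℕ.^ k) · 1# ≈ 0# → m · 1# ≈ 0#
  ^-·-1≈0 m k eq = decidable-stable (_ ≟ _) λ m≉0 → pow-≉0 k m≉0 (trans (sym (^-·-1 m k)) eq)

  q·1≈0 : q · 1# ≈ 0#
  q·1≈0 = ^-·-1≈0 q (2 ℕ.* t) cardinality-·-1

  -- As `q` is odd, `2 = 0` would turn `q · 1# = 0` into `1 = 0`.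
  2#≉0 : ¬ 1# + 1# ≈ 0#
  2#≉0 2≈0 = 1≉0 (begin
    1#                                        ≈⟨ +-identityʳ 1# ⟨
    1 · 1#                                    ≈⟨ +-identityʳ _ ⟨
    1 · 1# + 0#                               ≈⟨ +-congˡ (char∣⇒·≈0 {2} {q / 2 ℕ.* 2} (trans (+-congˡ (+-identityʳ 1#)) 2≈0) (divides (q / 2) ≡.refl) 1#) ⟨
    1 · 1# + (q / 2 ℕ.* 2) · 1#               ≈⟨ ×-homo-+ 1# 1 (q / 2 ℕ.* 2) ⟨
    (1 ℕ.+ q / 2 ℕ.* 2) · 1#                  ≡⟨ ≡.cong (_· 1#) (≡.trans (≡.cong (ℕ._+ q / 2 ℕ.* 2) (≡.sym odd)) (≡.sym (m≡m%n+[m/n]*n q 2))) ⟩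
    q · 1#                                    ≈⟨ q·1≈0 ⟩
    0#                                        ∎)

  σ : ℕ → F → F
  σ = frob q

  σ-cong : ∀ i {x y} → x ≈ y → σ i x ≈ σ i y
  σ-cong i = pow-cong (q ℕ.^ i)

  σ-* : ∀ i x y → σ i (x * y) ≈ σ i x * σ i y
  σ-* i x y = pow-distrib x y (q ℕ.^ i)

  σ-+ : ∀ i x y → σ i (x + y) ≈ σ i x + σ i y
  σ-+ i x y = let p , k , pr , _ , q≡p^k = primePower in ≡.subst (λ e → pow (x + y) e ≈ pow x e + pow y e)
    (≡.trans (≡.sym (ℕ.^-*-assoc p k i)) (≡.cong (ℕ._^ i) (≡.sym q≡p^k)))
    (pow-primePower-+ pr (^-·-1≈0 p k (trans (reflexive (≡.cong (_· 1#) (≡.sym q≡p^k))) q·1≈0)) (k ℕ.* i) x y)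

  σ-1 : ∀ i → σ i 1# ≈ 1#
  σ-1 i = pow-1# (q ℕ.^ i)

  σ-≉0 : ∀ i {x} → ¬ x ≈ 0# → ¬ σ i x ≈ 0#
  σ-≉0 i = pow-≉0 (q ℕ.^ i)

  σ-≈0 : ∀ i {x} → σ i x ≈ 0# → x ≈ 0#
  σ-≈0 i eq = decidable-stable (_ ≟ _) λ x≉0 → σ-≉0 i x≉0 eq

  σ-0 : ∀ i → σ i 0# ≈ 0#
  σ-0 i = begin
    σ i 0#                              ≈⟨ solve 1 (λ a → a := a :+ a :- a) refl (σ i 0#) ⟩
    σ i 0# + σ i 0# - σ i 0#            ≈⟨ +-congʳ (σ-+ i 0# 0#) ⟨
    σ i (0# + 0#) - σ i 0#              ≈⟨ +-congʳ (σ-cong i (+-identityˡ 0#)) ⟩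
    σ i 0# - σ i 0#                     ≈⟨ -‿inverseʳ _ ⟩
    0#                                  ∎

  σ-neg : ∀ i x → σ i (- x) ≈ - σ i x
  σ-neg i x = +-inverseˡ-unique _ _
    (trans (sym (σ-+ i (- x) x)) (trans (σ-cong i (-‿inverseˡ x)) (σ-0 i)))

  σ-- : ∀ i x y → σ i (x - y) ≈ σ i x - σ i y
  σ-- i x y = trans (σ-+ i x (- y)) (+-congˡ (σ-neg i y))

  σ-injective : ∀ i {x y} → σ i x ≈ σ i y → x ≈ y
  σ-injective i {x} {y} eq = x-y≈0⇒x≈y x y (σ-≈0 i (trans (σ-- i x y) (x≈y⇒x-y≈0 eq)))

  σ-∘ : ∀ i j x → σ i (σ j x) ≈ σ (i ℕ.+ j) x
  σ-∘ i j x = begin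
    pow (pow x (q ℕ.^ j)) (q ℕ.^ i)  ≈⟨ pow-* x (q ℕ.^ j) (q ℕ.^ i) ⟨
    pow x (q ℕ.^ j ℕ.* q ℕ.^ i)      ≡⟨ ≡.cong (pow x) (≡.trans (ℕ.*-comm (q ℕ.^ j) (q ℕ.^ i)) (≡.sym (ℕ.^-distribˡ-+-* q i j))) ⟩
    pow x (q ℕ.^ (i ℕ.+ j))          ∎

  σ-≡ : ∀ {i j} → i ≡ j → ∀ x → σ i x ≈ σ j x
  σ-≡ eq x = reflexive (≡.cong (λ k → σ k x) eq)

  σ-comm : ∀ i j x → σ i (σ j x) ≈ σ j (σ i x)
  σ-comm i j x = trans (σ-∘ i j x) (trans (σ-≡ (ℕ.+-comm i j) x) (sym (σ-∘ j i x)))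

  σ-identity : ∀ x → σ 0 x ≈ x
  σ-identity = *-identityʳ

  conj : F → F
  conj = σ t

  conj-involutive : ∀ x → conj (conj x) ≈ x
  conj-involutive x = trans (σ-∘ t t x)
    (trans (σ-≡ (≡.cong (t ℕ.+_) (≡.sym (ℕ.+-identityʳ t))) x) (pow-cardinality x))

  K V : F → Set ℓ
  K x = conj x ≈ x
  V x = conj x ≈ - x

  K-σ : ∀ i {x} → K x → K (σ i x)
  K-σ i {x} Kx = trans (σ-comm t i x) (σ-cong i Kx)

  K-* : ∀ {x y} → K x → K y → K (x * y)
  K-* Kx Ky = trans (σ-* t _ _) (*-cong Kx Ky)

  V-σ : ∀ i {x} → V x → V (σ i x)
  V-σ i {x} Vx = trans (σ-comm t i x) (trans (σ-cong i Vx) (σ-neg i x))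

  x*conj[x]∈K : ∀ x → K (x * conj x)
  x*conj[x]∈K x = trans (σ-* t _ _) (trans (*-congˡ (conj-involutive x)) (*-comm _ _))

  1<q : 1 ℕ.< q
  1<q = primePower>1 primePower

  instance
    q-nonZero : ℕ.NonZero q
    q-nonZero = ℕ.>-nonZero (ℕ.<-trans ℕ.z<s 1<q)

  q^[_]-1 : ℕ → ℕ
  q^[ i ]-1 = ℕ.pred (q ℕ.^ i)

  suc-q^[_]-1 : ∀ i → suc q^[ i ]-1 ≡ q ℕ.^ i
  suc-q^[ i ]-1 = ℕ.suc-pred (q ℕ.^ i) {{ℕ.m^n≢0 q i}}

  q^[2t] : suc (suc (q ℕ.^ t) ℕ.* q^[ t ]-1) ≡ q ℕ.^ (2 ℕ.* t)
  q^[2t] = [1+q^t]*[q^t-1] q t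

  0<q^[_]-1 : ∀ {i} → 0 ℕ.< i → 0 ℕ.< q^[ i ]-1
  0<q^[_]-1 {suc i} _ = ℕ.s<s⁻¹ (≡.subst (1 ℕ.<_) (≡.sym suc-q^[ suc i ]-1)
    (ℕ.≤-trans 1<q (ℕ.m≤m*n q (q ℕ.^ i) {{ℕ.m^n≢0 q i}})))

  -- For `k = y * conj y`, equality would give `σ r k = k` by injectivity of `σ i`, so a nonzero `y`
  -- would be a root of `X^((q^t + 1)(q^r - 1)) - 1`. Since `r < t`, this polynomial has too few
  -- roots to cover all nonzero `y`.
  separate : ∀ i r → 0 ℕ.< r → r ℕ.< t → ∃ λ k → K k × ¬ σ i k ≈ σ (i ℕ.+ r) k
  separate i r 0<r r<t with atMost⇒∃¬ (λ y → (y ≟ 0#) ⊎-dec (pow y e ≟ 1#))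
      (atMost-⊎ atMost-≈0 (atMost-pow e 1#)) bound
    where
    e = suc (q ℕ.^ t) ℕ.* q^[ r ]-1
    instance
      e-nonZero : ℕ.NonZero e
      e-nonZero = ℕ.m*n≢0 (suc (q ℕ.^ t)) q^[ r ]-1 {{_}} {{ℕ.>-nonZero (0<q^[_]-1 0<r)}}
    bound : 1 ℕ.+ e ℕ.< q ℕ.^ (2 ℕ.* t)
    bound = ≡.subst (1 ℕ.+ e ℕ.<_) q^[2t] (ℕ.s<s (ℕ.*-monoʳ-< (suc (q ℕ.^ t)) (ℕ.pred-mono-< {{ℕ.m^n≢0 q r}} (ℕ.^-monoʳ-< q 1<q r<t))))
  ... | y , ¬bad = y * conj y , x*conj[x]∈K y , λ eq → ¬bad (inj₂ (trans (pow-* y (suc (q ℕ.^ t)) q^[ r ]-1)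
      (*-cancelˡ (*-≉0 y≉0 (σ-≉0 t y≉0)) (begin
        (y * conj y) * pow (y * conj y) q^[ r ]-1  ≡⟨ ≡.cong (pow (y * conj y)) suc-q^[ r ]-1 ⟩
        σ r (y * conj y)                            ≈⟨ σ-injective i (trans (σ-∘ i r _) (sym eq)) ⟩
        y * conj y                                  ≈⟨ *-identityʳ _ ⟨
        (y * conj y) * 1#                           ∎))))
    where
    y≉0 : ¬ y ≈ 0#
    y≉0 y≈0 = ¬bad (inj₁ y≈0)

  -- The norm from `F` to the field with `q` elements.
  N : F → F
  N x = pow x (normExp q (2 ℕ.* t))

  N-cong : ∀ {x y} → x ≈ y → N x ≈ N y
  N-cong = pow-cong (normExp q (2 ℕ.* t))

  N-* : ∀ x y → N (x * y) ≈ N x * N y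
  N-* x y = pow-distrib x y (normExp q (2 ℕ.* t))

  N-≉0 : ∀ {x} → ¬ x ≈ 0# → ¬ N x ≈ 0#
  N-≉0 = pow-≉0 (normExp q (2 ℕ.* t))

  -- By `normExp-step`, `x^(q e + 1) = x^(q^(2t)) * x^e = x * x^e`; one factor `x` cancels.
  N-fixed : ∀ {x} → ¬ x ≈ 0# → pow (N x) q ≈ N x
  N-fixed {x} x≉0 = *-cancelʳ x≉0 (begin
    pow (pow x e) q * x          ≈⟨ *-cong (sym (pow-* x e q)) (sym (*-identityʳ x)) ⟩
    pow x (e ℕ.* q) * pow x 1    ≈⟨ pow-+ x (e ℕ.* q) 1 ⟨
    pow x (e ℕ.* q ℕ.+ 1)        ≡⟨ ≡.cong (pow x) (≡.trans (≡.cong (ℕ._+ 1) (ℕ.*-comm e q)) (normExp-step q (2 ℕ.* t))) ⟩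
    pow x (q ℕ.^ (2 ℕ.* t) ℕ.+ e) ≈⟨ pow-+ x (q ℕ.^ (2 ℕ.* t)) e ⟩
    pow x (q ℕ.^ (2 ℕ.* t)) * pow x e ≈⟨ *-congʳ (pow-cardinality x) ⟩
    x * pow x e                  ≈⟨ *-comm _ _ ⟩
    pow x e * x                  ∎)
    where e = normExp q (2 ℕ.* t)

  fixed-σ : ∀ i {x} → pow x q ≈ x → σ i x ≈ x
  fixed-σ zero    {x} eq = σ-identity x
  fixed-σ (suc i) {x} eq = trans (pow-* x q (q ℕ.^ i)) (trans (σ-cong i eq) (fixed-σ i eq))

  N-σ : ∀ i {x} → ¬ x ≈ 0# → N (σ i x) ≈ N x
  N-σ i {x} x≉0 = trans (pow-comm x (q ℕ.^ i) (normExp q (2 ℕ.* t))) (fixed-σ i (N-fixed x≉0))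

  -- Independence of the Frobenius powers on `K`

  Σ< : ℕ → (ℕ → F) → F
  Σ< zero    f = 0#
  Σ< (suc m) f = Σ< m f + f m

  Σ<-cong : ∀ m {f g} → (∀ i → i ℕ.< m → f i ≈ g i) → Σ< m f ≈ Σ< m g
  Σ<-cong zero    eq = refl
  Σ<-cong (suc m) eq = +-cong (Σ<-cong m (λ i i<m → eq i (ℕ.m<n⇒m<1+n i<m))) (eq m ℕ.≤-refl)

  Σ<-≈0 : ∀ m {f} → (∀ i → i ℕ.< m → f i ≈ 0#) → Σ< m f ≈ 0#
  Σ<-≈0 zero    eq = refl
  Σ<-≈0 (suc m) eq = trans (+-cong (Σ<-≈0 m (λ i i<m → eq i (ℕ.m<n⇒m<1+n i<m))) (eq m ℕ.≤-refl)) (+-identityˡ 0#)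

  Σ<-linear : ∀ m z f g → Σ< m (λ i → f i - z * g i) ≈ Σ< m f - z * Σ< m g
  Σ<-linear zero    z f g = solve 1 (λ z → con 0ℤ := con 0ℤ :- z :* con 0ℤ) refl z
  Σ<-linear (suc m) z f g = trans (+-congʳ (Σ<-linear m z f g))
    (solve 5 (λ z a b c d → a :- z :* b :+ (c :- z :* d) := a :+ c :- z :* (b :+ d)) refl
      z (Σ< m f) (Σ< m g) (f m) (g m))

  Σ<-+ : ∀ m f g → Σ< m (λ i → f i + g i) ≈ Σ< m f + Σ< m g
  Σ<-+ zero    f g = sym (+-identityˡ 0#)
  Σ<-+ (suc m) f g = trans (+-congʳ (Σ<-+ m f g))
    (solve 4 (λ a b c d → a :+ b :+ (c :+ d) := a :+ c :+ (b :+ d)) refl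
      (Σ< m f) (Σ< m g) (f m) (g m))

  -- Artin's argument: combining the relation at k₀k and at k eliminates σᵐ.
  eliminate : ∀ m (a : ℕ → F) k₀ k → Σ< (suc m) (λ i → a i * σ i (k₀ * k)) ≈ 0# → Σ< (suc m) (λ i → a i * σ i k) ≈ 0# →
    Σ< m (λ i → a i * (σ i k₀ - σ m k₀) * σ i k) ≈ 0#
  eliminate m a k₀ k vanish₁ vanish₂ = begin
    Σ< m h                            ≈⟨ +-identityʳ (Σ< m h) ⟨
    Σ< m h + 0#                       ≈⟨ +-congˡ top ⟨
    Σ< (suc m) h                      ≈⟨ Σ<-cong (suc m) {h} {λ i → f i - z * g i} (λ i _ → eq i) ⟩
    Σ< (suc m) (λ i → f i - z * g i)  ≈⟨ Σ<-linear (suc m) z f g ⟩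
    Σ< (suc m) f - z * Σ< (suc m) g   ≈⟨ +-cong vanish₁ (-‿cong (trans (*-congˡ vanish₂) (zeroʳ z))) ⟩
    0# - 0#                           ≈⟨ -‿inverseʳ 0# ⟩
    0#                                ∎
    where
    z = σ m k₀
    f g h : ℕ → F
    f i = a i * σ i (k₀ * k)
    g i = a i * σ i k
    h i = a i * (σ i k₀ - z) * σ i k
    eq : ∀ i → h i ≈ f i - z * g i
    eq i = trans (solve 4 (λ a x y z → a :* (x :- y) :* z := a :* (x :* z) :- y :* (a :* z)) refl (a i) (σ i k₀) z (σ i k))
      (+-congʳ (*-congˡ (sym (σ-* i k₀ k))))
    top : h m ≈ 0#
    top = trans (*-congʳ (trans (*-congˡ (-‿inverseʳ z)) (zeroʳ (a m)))) (zeroˡ (σ m k))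

  -- Induction on the number of terms. `eliminate` removes the top degree, and `separate` makes the
  -- factor `σ i k₀ - σ m k₀` nonzero, so the lower coefficients vanish; evaluating at 1 then leaves
  -- the top one. The bound `m ≤ t` is natural because `σ t` is the identity on `K`.
  σ-independent : ∀ m → m ℕ.≤ t → ∀ a → (∀ k → K k → Σ< m (λ i → a i * σ i k) ≈ 0#) →
    ∀ i → i ℕ.< m → a i ≈ 0#
  σ-independent (suc m) m<t a vanish = last
    where
    below : ∀ i → i ℕ.< m → a i ≈ 0#
    below i i<m =
      let k₀ , Kk₀ , σk₀≉ = separate i (m ℕ.∸ i) (ℕ.m<n⇒0<n∸m i<m) (ℕ.≤-<-trans (ℕ.m∸n≤m m i) m<t) in
      xy≈0⇒x≈0 {a i} {σ i k₀ - σ m k₀}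
        (λ eq → σk₀≉ (trans (x-y≈0⇒x≈y (σ i k₀) (σ m k₀) eq) (σ-≡ (≡.sym (ℕ.m+[n∸m]≡n (ℕ.<⇒≤ i<m))) k₀)))
        (σ-independent m (ℕ.<⇒≤ m<t) (λ i → a i * (σ i k₀ - σ m k₀))
          (λ k Kk → eliminate m a k₀ k (vanish (k₀ * k) (K-* Kk₀ Kk)) (vanish k Kk)) i i<m)
    last : ∀ i → i ℕ.< suc m → a i ≈ 0#
    last i i≤m with i ℕ.≟ m
    ... | no i≢m = below i (ℕ.≤∧≢⇒< (ℕ.s≤s⁻¹ i≤m) i≢m)
    ... | yes ≡.refl = begin
      a m                                            ≈⟨ *-identityʳ (a m) ⟨
      a m * 1#                                       ≈⟨ *-congˡ (σ-1 m) ⟨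
      a m * σ m 1#                                   ≈⟨ +-identityˡ (a m * σ m 1#) ⟨
      0# + a m * σ m 1#                              ≈⟨ +-congʳ (Σ<-≈0 m λ i i<m → trans (*-congʳ (below i i<m)) (zeroˡ (σ i 1#))) ⟨
      Σ< (suc m) (λ i → a i * σ i 1#)                ≈⟨ vanish 1# (σ-1 t) ⟩
      0#                                             ∎

  evaluate : List (ℕ × F) → F → F
  evaluate []             k = 0#
  evaluate ((r , a) ∷ ts) k = a * σ r k + evaluate ts k

  -- Degrees in a relation may coincide and may contain variables. A chain of `hit` and `miss`
  -- records which terms have degree `i` and collects their sum in the index.
  data Coefficient (i : ℕ) : List (ℕ × F) → F → Set c where
    []   : Coefficient i [] 0#
    hit  : ∀ {r a ts s} → r ≡ i → Coefficient i ts s → Coefficient i ((r , a) ∷ ts) (a + s)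
    miss : ∀ {r a ts s} → r ≢ i → Coefficient i ts s → Coefficient i ((r , a) ∷ ts) s

  private
    δ : ℕ → F → ℕ → F
    δ r a i with r ℕ.≟ i
    ... | yes _ = a
    ... | no  _ = 0#

    δ-hit : ∀ {r i} a → r ≡ i → δ r a i ≈ a
    δ-hit {r} {i} a r≡i with r ℕ.≟ i
    ... | yes _   = refl
    ... | no r≢i = contradiction r≡i r≢i

    δ-miss : ∀ {r i} a → r ≢ i → δ r a i ≈ 0#
    δ-miss {r} {i} a r≢i with r ℕ.≟ i
    ... | yes r≡i = contradiction r≡i r≢i
    ... | no _    = refl

    collect : List (ℕ × F) → ℕ → F
    collect []             i = 0#
    collect ((r , a) ∷ ts) i = δ r a i + collect ts i

    coefficient≈collect : ∀ {i ts s} → Coefficient i ts s → s ≈ collect ts i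
    coefficient≈collect []                       = refl
    coefficient≈collect (hit {a = a} r≡i coeff)  = +-cong (sym (δ-hit a r≡i)) (coefficient≈collect coeff)
    coefficient≈collect (miss {a = a} r≢i coeff) =
      trans (coefficient≈collect coeff) (trans (sym (+-identityˡ _)) (+-congʳ (sym (δ-miss a r≢i))))

    Σ<-δ : ∀ m {r} a k → r ℕ.< m → Σ< m (λ i → δ r a i * σ i k) ≈ a * σ r k
    Σ<-δ (suc m) {r} a k r≤m = split (r ℕ.≟ m)
      where
      split : Dec (r ≡ m) → Σ< (suc m) (λ i → δ r a i * σ i k) ≈ a * σ r k
      split (yes ≡.refl) = trans (+-cong
        (Σ<-≈0 m (λ i i<m → trans (*-congʳ (δ-miss a (λ m≡i → ℕ.<⇒≢ i<m (≡.sym m≡i)))) (zeroˡ (σ i k))))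
        (*-congʳ (δ-hit {m} a ≡.refl))) (+-identityˡ (a * σ m k))
      split (no r≢m) = trans (+-cong (Σ<-δ m a k (ℕ.≤∧≢⇒< (ℕ.s≤s⁻¹ r≤m) r≢m))
        (trans (*-congʳ (δ-miss a r≢m)) (zeroˡ (σ m k)))) (+-identityʳ (a * σ r k))

    evaluate≈Σ< : ∀ {ts} → All (λ s → proj₁ s ℕ.< t) ts → ∀ k → evaluate ts k ≈ Σ< t (λ i → collect ts i * σ i k)
    evaluate≈Σ< []                             k = sym (Σ<-≈0 t (λ _ _ → zeroˡ _))
    evaluate≈Σ< (_∷_ {x = r , a} {xs = ts} r<t all) k = begin
      a * σ r k + evaluate ts k                                               ≈⟨ +-cong (Σ<-δ t a k r<t) (sym (evaluate≈Σ< all k)) ⟨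
      Σ< t (λ i → δ r a i * σ i k) + Σ< t (λ i → collect ts i * σ i k)        ≈⟨ Σ<-+ t (λ i → δ r a i * σ i k) (λ i → collect ts i * σ i k) ⟨
      Σ< t (λ i → δ r a i * σ i k + collect ts i * σ i k)                     ≈⟨ Σ<-cong t (λ i _ → distribʳ (σ i k) (δ r a i) (collect ts i)) ⟨
      Σ< t (λ i → (δ r a i + collect ts i) * σ i k)                           ∎

  coefficient≈0 : ∀ {ts i s} → All (λ s → proj₁ s ℕ.< t) ts → (∀ k → K k → evaluate ts k ≈ 0#) →
    i ℕ.< t → Coefficient i ts s → s ≈ 0#
  coefficient≈0 {ts} {i} all vanish i<t coeff = trans (coefficient≈collect coeff)
    (σ-independent t ℕ.≤-refl (collect ts) (λ k Kk → trans (sym (evaluate≈Σ< all k)) (vanish k Kk)) i i<t)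

  -- Choice of the parameter `m`

  parameter : Exponents q t →
    ∃ λ m → K m × (¬ m ≈ 0#) × (¬ N m ≈ 1#) × (∀ b → V b → ¬ b * σ 1 b ≈ m)
  parameter (A , j , 0<A , [q+1]A≡ , count)
    -- The three alternatives exclude at most `1 + 2e + (q^t + 1) A` values of `y`, with `e` the
    -- norm exponent; the exponent `2e` appears because `N (y * conj y) = N y * N y`.
    with atMost⇒∃¬ (λ y → (y ≟ 0#) ⊎-dec ((pow y (e ℕ.+ e) ≟ 1#) ⊎-dec (pow y (suc (q ℕ.^ t) ℕ.* A) ≟ pow (- 1#) j)))
      (atMost-⊎ atMost-≈0 (atMost-⊎ (atMost-pow (e ℕ.+ e) 1#) (atMost-pow (suc (q ℕ.^ t) ℕ.* A) (pow (- 1#) j)))) count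
    where
    e = normExp q (2 ℕ.* t)
    instance
      e-nonZero : ℕ.NonZero (e ℕ.+ e)
      e-nonZero = ℕ.>-nonZero (ℕ.≤-trans (normExp>0 q (2 ℕ.* t) (ℕ.≤-trans 0<t (ℕ.m≤m+n t _))) (ℕ.m≤m+n e e))
      A-nonZero : ℕ.NonZero (suc (q ℕ.^ t) ℕ.* A)
      A-nonZero = ℕ.>-nonZero (ℕ.≤-trans 0<A (ℕ.m≤m+n A _))
  ... | y , ¬bad = m , x*conj[x]∈K y , *-≉0 y≉0 (σ-≉0 t y≉0) , Nm≉1 , avoided
    where
    m = y * conj y
    y≉0 : ¬ y ≈ 0#
    y≉0 eq = ¬bad (inj₁ eq)
    Nm≉1 : ¬ N m ≈ 1#
    Nm≉1 eq = ¬bad (inj₂ (inj₁ (begin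
      pow y (normExp q (2 ℕ.* t) ℕ.+ normExp q (2 ℕ.* t)) ≈⟨ pow-+ y (normExp q (2 ℕ.* t)) _ ⟩
      N y * N y                     ≈⟨ *-congˡ (N-σ t y≉0) ⟨
      N y * N (conj y)              ≈⟨ N-* y (conj y) ⟨
      N m                           ≈⟨ eq ⟩
      1#                            ∎)))
    avoided : ∀ b → V b → ¬ b * σ 1 b ≈ m
    -- A nonzero `b` in `V` satisfies `b^(q^t - 1) = -1`, so raising `b^(q + 1) = m` to the power
    -- `A` gives `(-1)^j`, a value that `y` avoids.
    avoided b Vb bσb≈m = ¬bad (inj₂ (inj₂ (begin
      pow y (suc (q ℕ.^ t) ℕ.* A)         ≈⟨ pow-* y (suc (q ℕ.^ t)) A ⟩
      pow m A                             ≈⟨ pow-cong A bσb≈m ⟨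
      pow (b * σ 1 b) A                   ≈⟨ pow-* b (suc (q ℕ.^ 1)) A ⟨
      pow b (suc (q ℕ.^ 1) ℕ.* A)         ≡⟨ ≡.cong (pow b) (≡.trans (≡.cong (λ k → suc k ℕ.* A) (ℕ.*-identityʳ q)) [q+1]A≡) ⟩
      pow b (q^[ t ]-1 ℕ.* j)             ≈⟨ pow-* b q^[ t ]-1 j ⟩
      pow (pow b q^[ t ]-1) j             ≈⟨ pow-cong j b^≈-1 ⟩
      pow (- 1#) j                        ∎)))
      where
      b≉0 : ¬ b ≈ 0#
      b≉0 b≈0 = *-≉0 y≉0 (σ-≉0 t y≉0) (trans (sym bσb≈m) (trans (*-congʳ b≈0) (zeroˡ (σ 1 b))))
      b^≈-1 : pow b q^[ t ]-1 ≈ - 1#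
      b^≈-1 = *-cancelˡ b≉0 (begin
        b * pow b q^[ t ]-1   ≡⟨ ≡.cong (pow b) suc-q^[ t ]-1 ⟩
        conj b                ≈⟨ Vb ⟩
        - b                   ≈⟨ solve 1 (λ b → :- b := b :* (:- con 1ℤ)) refl b ⟩
        b * - 1#              ∎)

  -- Scatteredness

  2# 4# : F
  2# = 1# + 1#
  4# = 2# * 2#

  4#≉0 : ¬ 4# ≈ 0#
  4#≉0 = *-≉0 2#≉0 2#≉0

  σ-4 : ∀ i → σ i 4# ≈ 4#
  σ-4 i = trans (σ-* i 2# 2#) (*-cong σ-2 σ-2)
    where σ-2 = trans (σ-+ i 1# 1#) (+-cong (σ-1 i) (σ-1 i))

  -- Twice the projections along F = K ⊕ V.
  P Q : F → F
  P x = x + conj x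
  Q x = x - conj x

  P∈K : ∀ x → K (P x)
  P∈K x = trans (σ-+ t x (conj x)) (trans (+-congˡ (conj-involutive x)) (+-comm _ _))

  Q∈V : ∀ x → V (Q x)
  Q∈V x = trans (σ-- t x (conj x)) (trans (+-congˡ (-‿cong (conj-involutive x)))
    (solve 2 (λ a b → a :- b := :- (b :- a)) refl (conj x) x))

  1+[t-1] : 1 ℕ.+ (t ℕ.∸ 1) ≡ t
  1+[t-1] = ℕ.m+[n∸m]≡n 0<t

  σσ⁻¹ : ∀ {x} → K x → σ 1 (σ (t ℕ.∸ 1) x) ≈ x
  σσ⁻¹ {x} Kx = trans (σ-∘ 1 (t ℕ.∸ 1) x) (trans (σ-≡ 1+[t-1] x) Kx)

  -- The four exponents form two pairs, `t - 1` with `2t - 1` and `1` with `t + 1`, each differing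
  -- by `t`, that is, by one conjugation.
  phi-decompose : ∀ m x → phi q t m x ≈ σ (t ℕ.∸ 1) (P x) + m * σ 1 (Q x)
  phi-decompose m x = sym (+-cong
    (trans (σ-+ (t ℕ.∸ 1) x (conj x)) (+-congˡ (trans (σ-∘ (t ℕ.∸ 1) t x) (σ-≡ [t-1]+t x))))
    (*-congˡ (trans (σ-- 1 x (conj x)) (+-congˡ (-‿cong (trans (σ-∘ 1 t x) (σ-≡ (ℕ.+-comm 1 t) x)))))))
    where
    [t-1]+t : t ℕ.∸ 1 ℕ.+ t ≡ 2 ℕ.* t ℕ.∸ 1
    [t-1]+t = ≡.trans (≡.sym (ℕ.+-∸-comm t 0<t)) (≡.cong (λ k → t ℕ.+ k ℕ.∸ 1) (≡.sym (ℕ.+-identityʳ t)))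

  module _ {m : F} (m∈K : K m) where

    S T : F → F
    S x = σ (t ℕ.∸ 1) (P x)
    T x = m * σ 1 (Q x)

    -- `S x` lies in `K` and `T x` in `V`, since `m` lies in `K`.
    conj-phi : ∀ x → conj (phi q t m x) ≈ S x - T x
    conj-phi x = begin
      conj (phi q t m x)                  ≈⟨ σ-cong t (phi-decompose m x) ⟩
      conj (S x + T x)                    ≈⟨ σ-+ t (S x) (T x) ⟩
      conj (S x) + conj (T x)             ≈⟨ +-cong (K-σ (t ℕ.∸ 1) (P∈K x)) (trans (σ-* t m (σ 1 (Q x))) (*-cong m∈K (V-σ 1 (Q∈V x)))) ⟩
      S x + m * - σ 1 (Q x)               ≈⟨ solve 3 (λ s m r → s :+ m :* (:- r) := s :- m :* r) refl (S x) m (σ 1 (Q x)) ⟩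
      S x - T x                           ∎

    module Eigenvalue (α : F) where
      a b : F
      a = P α
      b = Q α

      module _ {x : F} (eigen : phi q t m x ≈ α * x) where
        private
          S+T : S x + T x ≈ α * x
          S+T = trans (sym (phi-decompose m x)) eigen
          S-T : S x - T x ≈ conj α * conj x
          S-T = trans (sym (conj-phi x)) (trans (σ-cong t eigen) (σ-* t α x))

        -- The eigenvalue equation and its conjugate give `S + T` and `S - T`. The factor 4 arises
        -- because `P` and `Q` are twice the projections, for `α` as well as for `x`.
        4S≈ : 4# * S x ≈ a * P x + b * Q x
        4S≈ = begin
          4# * S x                                        ≈⟨ solve 2 (λ s u → (con 1ℤ :+ con 1ℤ) :* (con 1ℤ :+ con 1ℤ) :* s :=
                                                               (con 1ℤ :+ con 1ℤ) :* (s :+ u) :+ (con 1ℤ :+ con 1ℤ) :* (s :- u)) refl (S x) (T x) ⟩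
          2# * (S x + T x) + 2# * (S x - T x)             ≈⟨ +-cong (*-congˡ S+T) (*-congˡ S-T) ⟩
          2# * (α * x) + 2# * (conj α * conj x)           ≈⟨ solve 4 (λ α α' x x' →
                                                               (con 1ℤ :+ con 1ℤ) :* (α :* x) :+ (con 1ℤ :+ con 1ℤ) :* (α' :* x') :=
                                                               (α :+ α') :* (x :+ x') :+ (α :- α') :* (x :- x')) refl α (conj α) x (conj x) ⟩
          a * P x + b * Q x                               ∎

        4T≈ : 4# * T x ≈ a * Q x + b * P x
        4T≈ = begin
          4# * T x                                        ≈⟨ solve 2 (λ s u → (con 1ℤ :+ con 1ℤ) :* (con 1ℤ :+ con 1ℤ) :* u :=
                                                               (con 1ℤ :+ con 1ℤ) :* (s :+ u) :- (con 1ℤ :+ con 1ℤ) :* (s :- u)) refl (S x) (T x) ⟩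
          2# * (S x + T x) - 2# * (S x - T x)             ≈⟨ +-cong (*-congˡ S+T) (-‿cong (*-congˡ S-T)) ⟩
          2# * (α * x) - 2# * (conj α * conj x)           ≈⟨ solve 4 (λ α α' x x' →
                                                               (con 1ℤ :+ con 1ℤ) :* (α :* x) :- (con 1ℤ :+ con 1ℤ) :* (α' :* x') :=
                                                               (α :+ α') :* (x :- x') :+ (α :- α') :* (x :+ x')) refl α (conj α) x (conj x) ⟩
          a * Q x + b * P x                               ∎

        -- With `a = 0` the equations become `4 P = σ(b) σ(Q)` and `4 m σ(Q) = b P`; eliminating
        -- `σ(Q)` and cancelling `P` leaves the claim.
        traceless⇒16m : a ≈ 0# → ¬ P x ≈ 0# → 4# * (4# * m) ≈ b * σ 1 b
        traceless⇒16m a≈0 Px≉0 = *-cancelʳ Px≉0 (begin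
          4# * (4# * m) * P x            ≈⟨ solve 3 (λ f m p → f :* (f :* m) :* p := f :* m :* (f :* p)) refl 4# m (P x) ⟩
          4# * m * (4# * P x)            ≈⟨ *-congˡ 4P ⟩
          4# * m * (σ 1 b * σ 1 (Q x))   ≈⟨ solve 4 (λ f m s r → f :* m :* (s :* r) := s :* (f :* (m :* r))) refl 4# m (σ 1 b) (σ 1 (Q x)) ⟩
          σ 1 b * (4# * T x)             ≈⟨ *-congˡ (trans 4T≈ (a-drop (Q x) (b * P x))) ⟩
          σ 1 b * (b * P x)              ≈⟨ solve 3 (λ s b p → s :* (b :* p) := b :* s :* p) refl (σ 1 b) b (P x) ⟩
          b * σ 1 b * P x                ∎)
          where
          a-drop : ∀ y z → a * y + z ≈ z
          a-drop y z = trans (+-congʳ (trans (*-congʳ a≈0) (zeroˡ y))) (+-identityˡ z)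
          4P : 4# * P x ≈ σ 1 b * σ 1 (Q x)
          4P = begin
            4# * P x                  ≈⟨ *-cong (σ-4 1) (σσ⁻¹ (P∈K x)) ⟨
            σ 1 4# * σ 1 (S x)        ≈⟨ σ-* 1 4# (S x) ⟨
            σ 1 (4# * S x)            ≈⟨ σ-cong 1 (trans 4S≈ (a-drop (P x) (b * Q x))) ⟩
            σ 1 (b * Q x)             ≈⟨ σ-* 1 b (Q x) ⟩
            σ 1 b * σ 1 (Q x)         ∎

      module _ {x y : F} (eigen-x : phi q t m x ≈ α * x) (eigen-y : phi q t m y ≈ α * y) where

        -- Equal to `2 (conj x * y - x * conj y)`; for `y ≠ 0` it vanishes exactly when `x / y` lies
        -- in `K`.
        W : F
        W = P x * Q y - P y * Q x

        -- In `4 (S x * Q y - S y * Q x)` the terms with `b` cancel and `a * W` remains. Applying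
        -- `σ 1` turns `S` into `P`, and `m` completes `σ 1 (Q _)` to `T`, where the terms with `b`
        -- cancel once more.
        twisted-fixed : m * σ 1 (a * W) ≈ a * W
        twisted-fixed = begin
          m * σ 1 (a * W)                               ≈⟨ *-congˡ (σ-cong 1 aW≈) ⟨
          m * σ 1 (4# * (S x * Q y - S y * Q x))        ≈⟨ *-congˡ σ-expand ⟩
          m * (4# * (P x * σ 1 (Q y) - P y * σ 1 (Q x))) ≈⟨ solve 6 (λ m f p u r v → m :* (f :* (p :* u :- r :* v)) := p :* (f :* (m :* u)) :- r :* (f :* (m :* v)))
                                                            refl m 4# (P x) (σ 1 (Q y)) (P y) (σ 1 (Q x)) ⟩
          P x * (4# * T y) - P y * (4# * T x)           ≈⟨ +-cong (*-congˡ (4T≈ eigen-y)) (-‿cong (*-congˡ (4T≈ eigen-x))) ⟩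
          P x * (a * Q y + b * P y) - P y * (a * Q x + b * P x) ≈⟨ solve 6 (λ a b p u r v → p :* (a :* u :+ b :* r) :- r :* (a :* v :+ b :* p) := a :* (p :* u :- r :* v))
                                                            refl a b (P x) (Q y) (P y) (Q x) ⟩
          a * W                                         ∎
          where
          aW≈ : 4# * (S x * Q y - S y * Q x) ≈ a * W
          aW≈ = begin
            4# * (S x * Q y - S y * Q x)                ≈⟨ solve 5 (λ f s u r v → f :* (s :* u :- r :* v) := f :* s :* u :- f :* r :* v) refl 4# (S x) (Q y) (S y) (Q x) ⟩
            4# * S x * Q y - 4# * S y * Q x             ≈⟨ +-cong (*-congʳ (4S≈ eigen-x)) (-‿cong (*-congʳ (4S≈ eigen-y))) ⟩
            (a * P x + b * Q x) * Q y - (a * P y + b * Q y) * Q x ≈⟨ solve 6 (λ a b p u r v → (a :* p :+ b :* v) :* u :- (a :* r :+ b :* u) :* v := a :* (p :* u :- r :* v))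
                                                            refl a b (P x) (Q y) (P y) (Q x) ⟩
            a * W                                       ∎
          σ-expand : σ 1 (4# * (S x * Q y - S y * Q x)) ≈ 4# * (P x * σ 1 (Q y) - P y * σ 1 (Q x))
          σ-expand = trans (σ-* 1 4# (S x * Q y - S y * Q x)) (*-cong (σ-4 1)
            (trans (σ-- 1 (S x * Q y) (S y * Q x)) (+-cong
              (trans (σ-* 1 (S x) (Q y)) (*-congʳ (σσ⁻¹ (P∈K x))))
              (-‿cong (trans (σ-* 1 (S y) (Q x)) (*-congʳ (σσ⁻¹ (P∈K y))))))))

      -- `P` and `Q` both scale by `r`, and so do the right-hand sides of `4S≈` and `4T≈`, whereas
      -- `S` scales by the inverse Frobenius image of `r` and `T` by `σ 1 r`. The first is used if
      -- `P y ≠ 0`, the second if `Q y ≠ 0`.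
      K-proportional : ∀ {r x y} → K r → ¬ m ≈ 0# → ¬ y ≈ 0# → x ≈ r * y →
        phi q t m x ≈ α * x → phi q t m y ≈ α * y → σ 1 r ≈ r
      K-proportional {r} {x} {y} Kr m≉0 y≉0 x≈ry eigen-x eigen-y = split (P y ≟ 0#)
        where
        conj-x : conj x ≈ r * conj y
        conj-x = trans (σ-cong t x≈ry) (trans (σ-* t r y) (*-congʳ Kr))
        Px≈ : P x ≈ r * P y
        Px≈ = trans (+-cong x≈ry conj-x) (sym (distribˡ r y (conj y)))
        Qx≈ : Q x ≈ r * Q y
        Qx≈ = trans (+-cong x≈ry (-‿cong conj-x)) (sym (x[y-z]≈xy-xz r y (conj y)))
        scaled : ∀ {u v w z} → u ≈ r * w → v ≈ r * z → a * u + b * v ≈ r * (a * w + b * z)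
        scaled {u} {v} {w} {z} u≈ v≈ = trans (+-cong (*-congˡ u≈) (*-congˡ v≈))
          (solve 5 (λ a b r w z → a :* (r :* w) :+ b :* (r :* z) := r :* (a :* w :+ b :* z)) refl a b r w z)
        swap : ∀ f r s → r * (f * s) ≈ f * (r * s)
        swap = solve 3 (λ f r s → r :* (f :* s) := f :* (r :* s)) refl
        split : Dec (P y ≈ 0#) → σ 1 r ≈ r
        split (no Py≉0) = trans (σ-cong 1 (sym σ⁻¹r≈r)) (σσ⁻¹ Kr)
          where
          σ⁻¹r≈r : σ (t ℕ.∸ 1) r ≈ r
          σ⁻¹r≈r = *-cancelʳ (σ-≉0 (t ℕ.∸ 1) Py≉0) (*-cancelˡ 4#≉0 (begin
            4# * (σ (t ℕ.∸ 1) r * S y)       ≈⟨ *-congˡ (trans (σ-cong (t ℕ.∸ 1) Px≈) (σ-* (t ℕ.∸ 1) r (P y))) ⟨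
            4# * S x                         ≈⟨ 4S≈ eigen-x ⟩
            a * P x + b * Q x                ≈⟨ scaled Px≈ Qx≈ ⟩
            r * (a * P y + b * Q y)          ≈⟨ *-congˡ (4S≈ eigen-y) ⟨
            r * (4# * S y)                   ≈⟨ swap 4# r (S y) ⟩
            4# * (r * S y)                   ∎))
        split (yes Py≈0) = *-cancelʳ (*-≉0 m≉0 (σ-≉0 1 Qy≉0)) (*-cancelˡ 4#≉0 (begin
            4# * (σ 1 r * T y)               ≈⟨ *-congˡ (trans (swap m (σ 1 r) (σ 1 (Q y))) (*-congˡ (sym (trans (σ-cong 1 Qx≈) (σ-* 1 r (Q y)))))) ⟩
            4# * T x                         ≈⟨ 4T≈ eigen-x ⟩
            a * Q x + b * P x                ≈⟨ scaled Qx≈ Px≈ ⟩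
            r * (a * Q y + b * P y)          ≈⟨ *-congˡ (4T≈ eigen-y) ⟨
            r * (4# * T y)                   ≈⟨ swap 4# r (T y) ⟩
            4# * (r * T y)                   ∎))
          where
          Qy≉0 : ¬ Q y ≈ 0#
          Qy≉0 Qy≈0 = *-≉0 2#≉0 y≉0 (begin
            2# * y       ≈⟨ solve 2 (λ y z → (con 1ℤ :+ con 1ℤ) :* y := (y :+ z) :+ (y :- z)) refl y (conj y) ⟩
            P y + Q y    ≈⟨ +-cong Py≈0 Qy≈0 ⟩
            0# + 0#      ≈⟨ +-identityˡ 0# ⟩
            0#           ∎)

  module _ {m : F} (m∈K : K m) (m≉0 : ¬ m ≈ 0#) (Nm≉1 : ¬ N m ≈ 1#)
    (m≉bσb : ∀ b → V b → ¬ b * σ 1 b ≈ m) where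

    phi-scattered : Scattered q (phi q t m)
    phi-scattered x y x⁻¹ y⁻¹ x≉0 y≉0 xx⁻¹≈1 yy⁻¹≈1 ratio = split (W₁ ≟ 0#)
      where
      α = phi q t m x * x⁻¹
      open Eigenvalue m∈K α
      divided : ∀ {z z⁻¹} → z * z⁻¹ ≈ 1# → phi q t m z ≈ phi q t m z * z⁻¹ * z
      divided {z} {z⁻¹} zz⁻¹≈1 = sym (trans (*-assoc (phi q t m z) z⁻¹ z)
        (trans (*-congˡ (trans (*-comm z⁻¹ z) zz⁻¹≈1)) (*-identityʳ (phi q t m z))))
      eigen-x : phi q t m x ≈ α * x
      eigen-x = divided xx⁻¹≈1
      eigen-y : phi q t m y ≈ α * y
      eigen-y = trans (divided yy⁻¹≈1) (*-congʳ (sym ratio))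
      W₁ = W eigen-x eigen-y
      r = x * y⁻¹
      x≈ry : x ≈ r * y
      x≈ry = sym (trans (*-assoc x y⁻¹ y) (trans (*-congˡ (trans (*-comm y⁻¹ y) yy⁻¹≈1)) (*-identityʳ x)))

      aW≈0 : a * W₁ ≈ 0#
      -- The norm is Frobenius-invariant, so a nonzero `z` with `m * σ 1 z = z` would force
      -- `N m = 1`.
      aW≈0 = decidable-stable (_ ≟ _) λ aW≉0 → Nm≉1 (*-cancelʳ (N-≉0 aW≉0) (begin
        N m * N (a * W₁)           ≈⟨ *-congˡ (N-σ 1 aW≉0) ⟨
        N m * N (σ 1 (a * W₁))     ≈⟨ N-* m (σ 1 (a * W₁)) ⟨
        N (m * σ 1 (a * W₁))       ≈⟨ N-cong (twisted-fixed eigen-x eigen-y) ⟩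
        N (a * W₁)                 ≈⟨ *-identityˡ (N (a * W₁)) ⟨
        1# * N (a * W₁)            ∎))

      split : Dec (W₁ ≈ 0#) → σ 1 r ≈ r
      split (yes W≈0) = K-proportional r∈K m≉0 y≉0 x≈ry eigen-x eigen-y
        where
        conj-x*y : conj x * y ≈ x * conj y
        conj-x*y = x-y≈0⇒x≈y (conj x * y) (x * conj y) (xy≈0⇒y≈0 2#≉0 (trans
          (solve 4 (λ x x' y y' → (con 1ℤ :+ con 1ℤ) :* (x' :* y :- x :* y') := (x :+ x') :* (y :- y') :- (y :+ y') :* (x :- x'))
            refl x (conj x) y (conj y)) W≈0))
        r∈K : K r
        r∈K = *-cancelʳ (*-≉0 y≉0 (σ-≉0 t y≉0)) (begin
          conj r * (y * conj y)    ≈⟨ solve 3 (λ r y y' → r :* (y :* y') := r :* y' :* y) refl (conj r) y (conj y) ⟩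
          conj r * conj y * y      ≈⟨ *-congʳ (trans (σ-cong t x≈ry) (σ-* t r y)) ⟨
          conj x * y               ≈⟨ conj-x*y ⟩
          x * conj y               ≈⟨ *-congʳ x≈ry ⟩
          r * y * conj y           ≈⟨ *-assoc r y (conj y) ⟩
          r * (y * conj y)         ∎)
      split (no W≉0) = contradiction 16m≈bσb m≉quarter
        where
        a≈0 : a ≈ 0#
        a≈0 = xy≈0⇒x≈0 W≉0 aW≈0
        16m≈bσb : 4# * (4# * m) ≈ b * σ 1 b
        -- `W₁ ≠ 0` excludes `P x = P y = 0`, so at least one of the two eigenvectors yields the
        -- equation.
        16m≈bσb with P x ≟ 0# | P y ≟ 0#
        ... | no Px≉0  | _        = traceless⇒16m eigen-x a≈0 Px≉0
        ... | _        | no Py≉0  = traceless⇒16m eigen-y a≈0 Py≉0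
        ... | yes Px≈0 | yes Py≈0 = contradiction (begin
          P x * Q y - P y * Q x    ≈⟨ +-cong (*-congʳ Px≈0) (-‿cong (*-congʳ Py≈0)) ⟩
          0# * Q y - 0# * Q x      ≈⟨ solve 2 (λ a b → con 0ℤ :* a :- con 0ℤ :* b := con 0ℤ) refl (Q y) (Q x) ⟩
          0#                       ∎) W≉0
        m≉quarter : ¬ 4# * (4# * m) ≈ b * σ 1 b
        -- `¼` is fixed by every `σ i`, conjugation included; hence `b * ¼` stays in `V` and
        -- contradicts the choice of `m`.
        m≉quarter eq = m≉bσb (b * ¼) Vb¼ (begin
          b * ¼ * σ 1 (b * ¼)          ≈⟨ *-congˡ (trans (σ-* 1 b ¼) (*-congˡ (σ-¼ 1))) ⟩
          b * ¼ * (σ 1 b * ¼)          ≈⟨ solve 3 (λ b s e → b :* e :* (s :* e) := b :* s :* (e :* e)) refl b (σ 1 b) ¼ ⟩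
          b * σ 1 b * (¼ * ¼)          ≈⟨ *-congʳ eq ⟨
          4# * (4# * m) * (¼ * ¼)      ≈⟨ solve 3 (λ f m e → f :* (f :* m) :* (e :* e) := (f :* e) :* (f :* e) :* m) refl 4# m ¼ ⟩
          4# * ¼ * (4# * ¼) * m        ≈⟨ *-congʳ (*-cong 4¼≈1 4¼≈1) ⟩
          1# * 1# * m                  ≈⟨ trans (*-congʳ (*-identityˡ 1#)) (*-identityˡ m) ⟩
          m                            ∎)
          where
          ¼ = proj₁ (inverse 4# 4#≉0)
          4¼≈1 = proj₂ (inverse 4# 4#≉0)
          σ-¼ : ∀ i → σ i ¼ ≈ ¼
          σ-¼ i = *-cancelˡ 4#≉0 (trans (*-congʳ (sym (σ-4 i))) (trans (sym (σ-* i 4# ¼))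
            (trans (σ-cong i 4¼≈1) (trans (σ-1 i) (sym 4¼≈1)))))
          Vb¼ : V (b * ¼)
          Vb¼ = trans (σ-* t b ¼) (trans (*-cong (Q∈V α) (σ-¼ t)) (sym (-‿distribˡ-* b ¼)))

  -- Additive maps semilinear over `K`, graded by the power of `σ`

  record Homogeneous (r : ℕ) (g : F → F) : Set (c ⊔ ℓ) where
    field
      g-cong : ∀ {x y} → x ≈ y → g x ≈ g y
      g-+    : ∀ x y → g (x + y) ≈ g x + g y
      g-K    : ∀ {k} y → K k → g (k * y) ≈ σ r k * g y

  homogeneous-combination : ∀ {r g k l x y} → Homogeneous r g → K k → K l →
    g (k * x + l * y) ≈ σ r k * g x + σ r l * g y
  homogeneous-combination {k = k} {l} {x} {y} hom Kk Kl =
    trans (g-+ (k * x) (l * y)) (+-cong (g-K x Kk) (g-K y Kl))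
    where open Homogeneous hom

  σ-homogeneous : ∀ r → Homogeneous r (σ r)
  σ-homogeneous r = record { g-cong = σ-cong r ; g-+ = σ-+ r ; g-K = λ {k} y _ → σ-* r k y }

  zero-homogeneous : ∀ r → Homogeneous r (λ _ → 0#)
  zero-homogeneous r = record { g-cong = λ _ → refl ; g-+ = λ _ _ → sym (+-identityˡ 0#) ; g-K = λ {k} _ _ → sym (zeroʳ (σ r k)) }

  +-homogeneous : ∀ {r f g} → Homogeneous r f → Homogeneous r g → Homogeneous r (λ x → f x + g x)
  +-homogeneous {r} {f} {g} F-hom G-hom = record
    { g-cong = λ x≈y → +-cong (f.g-cong x≈y) (g.g-cong x≈y)
    ; g-+ = λ x y → trans (+-cong (f.g-+ x y) (g.g-+ x y))
        (solve 4 (λ a b c d → (a :+ b) :+ (c :+ d) := (a :+ c) :+ (b :+ d)) refl (f x) (f y) (g x) (g y))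
    ; g-K = λ {k} y Kk → trans (+-cong (f.g-K y Kk) (g.g-K y Kk)) (sym (distribˡ (σ r k) (f y) (g y)))
    }
    where
    module f = Homogeneous F-hom
    module g = Homogeneous G-hom

  *-homogeneous : ∀ {r g} z → Homogeneous r g → Homogeneous r (λ x → z * g x)
  *-homogeneous {r} {g} z G-hom = record
    { g-cong = λ x≈y → *-congˡ (g.g-cong x≈y)
    ; g-+ = λ x y → trans (*-congˡ (g.g-+ x y)) (distribˡ z (g x) (g y))
    ; g-K = λ {k} y Kk → trans (*-congˡ (g.g-K y Kk))
        (solve 3 (λ z s y → z :* (s :* y) := s :* (z :* y)) refl z (σ r k) (g y))
    }
    where module g = Homogeneous G-hom

  -- Only the action of `σ r` on `K` enters, so a degree may be changed by multiples of `t`.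
  regrade : ∀ {r r′ g} → (∀ k → K k → σ r k ≈ σ r′ k) → Homogeneous r g → Homogeneous r′ g
  regrade eq G-hom = record
    { g-cong = g-cong ; g-+ = g-+ ; g-K = λ {k} y Kk → trans (g-K y Kk) (*-congʳ (eq k Kk)) }
    where open Homogeneous G-hom

  σ-*t : ∀ j {k} → K k → σ (j ℕ.* t) k ≈ k
  σ-*t zero    {k} Kk = σ-identity k
  σ-*t (suc j) {k} Kk = trans (sym (σ-∘ t (j ℕ.* t) k)) (trans (σ-cong t (σ-*t j Kk)) Kk)

  σ-+*t : ∀ r j k → K k → σ (r ℕ.+ j ℕ.* t) k ≈ σ r k
  σ-+*t r j k Kk = trans (sym (σ-∘ r (j ℕ.* t) k)) (σ-cong r (σ-*t j Kk))

  -- Both sides become `k` after applying the injective map `σ s`; this identifies the degree of the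
  -- inverse of `σ s` on `K`.
  σ-complement : ∀ s {e e′} j j′ → s ℕ.+ e ≡ j ℕ.* t → s ℕ.+ e′ ≡ j′ ℕ.* t → ∀ k → K k → σ e k ≈ σ e′ k
  σ-complement s {e} {e′} j j′ eq eq′ k Kk = σ-injective s
    (trans (trans (σ-∘ s e k) (trans (σ-≡ eq k) (σ-*t j Kk)))
      (sym (trans (σ-∘ s e′ k) (trans (σ-≡ eq′ k) (σ-*t j′ Kk)))))

  -- The polynomial `X^(q^t) - X` has too few roots, so some `y` differs from its conjugate and
  -- `Q y` is nonzero.
  ∃V : ∃ λ w → V w × ¬ w ≈ 0#
  ∃V with atMost⇒∃¬ (λ y → (y ≟ 0#) ⊎-dec (pow y q^[ t ]-1 ≟ 1#))
      (atMost-⊎ atMost-≈0 (atMost-pow q^[ t ]-1 {{ℕ.>-nonZero (0<q^[_]-1 0<t)}} 1#))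
      (≡.subst (ℕ._< q ℕ.^ (2 ℕ.* t)) (≡.sym suc-q^[ t ]-1) (ℕ.^-monoʳ-< q 1<q (ℕ.m<m+n t (ℕ.≤-trans 0<t (ℕ.m≤m+n t 0)))))
  ... | y , ¬bad = Q y , Q∈V y , λ Qy≈0 → ¬bad (inj₂ (*-cancelˡ (λ y≈0 → ¬bad (inj₁ y≈0)) (begin
      y * pow y q^[ t ]-1   ≡⟨ ≡.cong (pow y) suc-q^[ t ]-1 ⟩
      conj y                ≈⟨ x-y≈0⇒x≈y y (conj y) Qy≈0 ⟨
      y                     ≈⟨ *-identityʳ y ⟨
      y * 1#                ∎)))

  K-σ⁻¹ : ∀ ρ {k} → K k → σ (suc ρ) (σ (t ℕ.∸ 1) k) ≈ σ ρ k
  K-σ⁻¹ ρ {k} Kk = trans (σ-∘ (suc ρ) (t ℕ.∸ 1) k) (trans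
    (σ-≡ (≡.trans (≡.sym (ℕ.+-suc ρ (t ℕ.∸ 1))) (≡.cong (ρ ℕ.+_) 1+[t-1])) k)
    (trans (sym (σ-∘ ρ t k)) (σ-cong ρ Kk)))

  phi-K : ∀ m {k} → K k → phi q t m k ≈ 2# * σ (t ℕ.∸ 1) k
  phi-K m {k} Kk = begin
    phi q t m k                                 ≈⟨ phi-decompose m k ⟩
    σ (t ℕ.∸ 1) (P k) + m * σ 1 (Q k)           ≈⟨ +-cong (trans (σ-cong (t ℕ.∸ 1) (+-congˡ Kk)) (σ-+ (t ℕ.∸ 1) k k))
                                                     (*-congˡ (trans (σ-cong 1 (trans (+-congˡ (-‿cong Kk)) (-‿inverseʳ k))) (σ-0 1))) ⟩
    σ (t ℕ.∸ 1) k + σ (t ℕ.∸ 1) k + m * 0#      ≈⟨ solve 2 (λ s m → s :+ s :+ m :* con 0ℤ := (con 1ℤ :+ con 1ℤ) :* s) refl (σ (t ℕ.∸ 1) k) m ⟩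
    2# * σ (t ℕ.∸ 1) k                          ∎

  phi-V : ∀ m {v} → V v → phi q t m v ≈ 2# * (m * σ 1 v)
  phi-V m {v} Vv = begin
    phi q t m v                                 ≈⟨ phi-decompose m v ⟩
    σ (t ℕ.∸ 1) (P v) + m * σ 1 (Q v)           ≈⟨ +-cong (trans (σ-cong (t ℕ.∸ 1) (trans (+-congˡ Vv) (-‿inverseʳ v))) (σ-0 (t ℕ.∸ 1)))
                                                     (*-congˡ (trans (σ-- 1 v (conj v)) (+-congˡ (-‿cong (trans (σ-cong 1 Vv) (σ-neg 1 v)))))) ⟩
    0# + m * (σ 1 v - - σ 1 v)                  ≈⟨ solve 2 (λ s m → con 0ℤ :+ m :* (s :- (:- s)) := (con 1ℤ :+ con 1ℤ) :* (m :* s)) refl (σ 1 v) m ⟩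
    2# * (m * σ 1 v)                            ∎

  Injective₀ : (F → F) → Set (c ⊔ ℓ)
  Injective₀ g = ∀ y → g y ≈ 0# → y ≈ 0#

  -- What family (iii) offers in place of injectivity: a zero at `y` or at `y * w` controls the norm
  -- of the value at the other point.
  Balanced : (F → F) → Set (c ⊔ ℓ)
  Balanced g = ∀ y w → ¬ y ≈ 0# → V w → ¬ w ≈ 0# →
    (g y ≈ 0# → N (g (y * w)) ≈ N (2# * (y * w))) × (g (y * w) ≈ 0# → N (g y) ≈ N (2# * y))

  -- Sums read off from `Coefficient` end in `+ 0#`; this and the next two lemmas bring them into
  -- usable form.
  x+[-y+0]≈0⇒x≈y : ∀ {x y} → x + (- y + 0#) ≈ 0# → x ≈ y
  x+[-y+0]≈0⇒x≈y {x} {y} eq = x-y≈0⇒x≈y x y (trans (+-congˡ (sym (+-identityʳ (- y)))) eq)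

  -x+0≈0⇒x≈0 : ∀ {x} → - x + 0# ≈ 0# → x ≈ 0#
  -x+0≈0⇒x≈0 {x} eq = trans (solve 1 (λ x → x := :- (:- x :+ con 0ℤ)) refl x) (trans (-‿cong eq) -0#≈0#)

  x+0≈0⇒x≈0 : ∀ {x} → x + 0# ≈ 0# → x ≈ 0#
  x+0≈0⇒x≈0 {x} eq = trans (sym (+-identityʳ x)) eq

  -- Comparison of coefficients on `K` and on `V`

  module _ (a b c′ d : F) {m : F} (m∈K : K m) (m≉0 : ¬ m ≈ 0#) (Nm≉1 : ¬ N m ≈ 1#)
    (det≉0 : ¬ a * d - b * c′ ≈ 0#) where

    -- On `K` and on `V` the map `φ` carries a factor 2, which is absorbed into `b` and `d`.
    b₂ d₂ : F
    b₂ = b * 2#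
    d₂ = d * 2#

    b₂≈0⇒b≈0 : b₂ ≈ 0# → b ≈ 0#
    b₂≈0⇒b≈0 = xy≈0⇒x≈0 2#≉0

    det≈0-columns : a ≈ 0# → b ≈ 0# → ⊥
    det≈0-columns a≈0 b≈0 = det≉0 (trans (+-cong (*-congʳ a≈0) (-‿cong (*-congʳ b≈0)))
      (solve 2 (λ d c → con 0ℤ :* d :- con 0ℤ :* c := con 0ℤ) refl d c′))

    det≈0-rows : c′ ≈ 0# → d ≈ 0# → ⊥
    det≈0-rows c≈0 d≈0 = det≉0 (trans (+-cong (*-congˡ d≈0) (-‿cong (*-congˡ c≈0)))
      (solve 2 (λ a b → a :* con 0ℤ :- b :* con 0ℤ := con 0ℤ) refl a b))

    module Homogeneous-parts {ρ ρ′ : ℕ} {g₊ g₋ : F → F}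
      (hom₊ : Homogeneous (suc ρ) g₊) (hom₋ : Homogeneous (suc ρ′) g₋)
      (eq : ∀ x → g₊ (a * x + b * phi q t m x) + g₋ (a * x + b * phi q t m x) ≈ c′ * x + d * phi q t m x)
      where
      -- On `K` the map `φ` is twice the inverse of `σ`, so the term with `b` has degree one less
      -- than that with `a`. The variable `e` stands for `t - 1` and is later instantiated by
      -- `4 + κ`.
      K-terms : ℕ → List (ℕ × F)
      K-terms e = (suc ρ , g₊ a) ∷ (ρ , g₊ b₂) ∷ (suc ρ′ , g₋ a) ∷ (ρ′ , g₋ b₂) ∷ (0 , - c′) ∷ (e , - d₂) ∷ []

      K-relation : ∀ e → suc e ≡ t → ∀ k → K k → evaluate (K-terms e) k ≈ 0#
      K-relation e suc-e≡t k Kk = begin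
        evaluate (K-terms e) k
          ≈⟨ solve 12 (λ p₁ s₁ p₂ s₂ p₃ s₃ p₄ s₄ p₅ s₅ p₆ s₆ →
               p₁ :* s₁ :+ (p₂ :* s₂ :+ (p₃ :* s₃ :+ (p₄ :* s₄ :+ (:- p₅ :* s₅ :+ (:- p₆ :* s₆ :+ con 0ℤ))))) :=
               (s₁ :* p₁ :+ s₂ :* p₂) :+ (s₃ :* p₃ :+ s₄ :* p₄) :- (p₅ :* s₅ :+ p₆ :* s₆)) refl
               (g₊ a) (σ (suc ρ) k) (g₊ b₂) (σ ρ k) (g₋ a) (σ (suc ρ′) k) (g₋ b₂) (σ ρ′ k) c′ (σ 0 k) d₂ (σ e k) ⟩
        (σ (suc ρ) k * g₊ a + σ ρ k * g₊ b₂) + (σ (suc ρ′) k * g₋ a + σ ρ′ k * g₋ b₂) - (c′ * σ 0 k + d₂ * σ e k)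
          ≈⟨ +-cong (+-cong (part hom₊) (part hom₋)) (-‿cong right) ⟩
        g₊ (a * k + b * phi q t m k) + g₋ (a * k + b * phi q t m k) - (c′ * k + d * phi q t m k)
          ≈⟨ x≈y⇒x-y≈0 (eq k) ⟩
        0# ∎
        where
        k⁻ = σ (t ℕ.∸ 1) k
        argument : k * a + k⁻ * b₂ ≈ a * k + b * phi q t m k
        argument = trans (solve 5 (λ k a s b z → k :* a :+ s :* (b :* z) := a :* k :+ b :* (z :* s)) refl k a k⁻ b 2#)
          (+-congˡ (*-congˡ (sym (phi-K m Kk))))
        part : ∀ {r g} → Homogeneous (suc r) g →
          σ (suc r) k * g a + σ r k * g b₂ ≈ g (a * k + b * phi q t m k)
        part {r} {g} hom = begin
          σ (suc r) k * g a + σ r k * g b₂           ≈⟨ +-congˡ (*-congʳ (K-σ⁻¹ r Kk)) ⟨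
          σ (suc r) k * g a + σ (suc r) k⁻ * g b₂    ≈⟨ homogeneous-combination hom Kk (K-σ (t ℕ.∸ 1) Kk) ⟨
          g (k * a + k⁻ * b₂)                        ≈⟨ Homogeneous.g-cong hom argument ⟩
          g (a * k + b * phi q t m k)                ∎
        right : c′ * σ 0 k + d₂ * σ e k ≈ c′ * k + d * phi q t m k
        right = +-cong (*-congˡ (σ-identity k)) (begin
          d * 2# * σ e k                ≈⟨ *-assoc d 2# (σ e k) ⟩
          d * (2# * σ e k)              ≈⟨ *-congˡ (*-congˡ (σ-≡ (≡.cong (ℕ._∸ 1) suc-e≡t) k)) ⟩
          d * (2# * k⁻)                 ≈⟨ *-congˡ (phi-K m Kk) ⟨
          d * phi q t m k               ∎)

      module _ {e : ℕ} (suc-e≡t : suc e ≡ t) (e<t : e ℕ.< t) (sum : suc ρ ℕ.+ suc ρ′ ≡ t) where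
        private
          ρ<t : suc ρ ℕ.< t
          ρ<t = ≡.subst (suc ρ ℕ.<_) sum (ℕ.m<m+n (suc ρ) ℕ.z<s)
          ρ′<t : suc ρ′ ℕ.< t
          ρ′<t = ≡.subst (suc ρ′ ℕ.<_) sum (ℕ.m<n+m (suc ρ′) ℕ.z<s)

        K-coefficient≈0 : ∀ {i s} → i ℕ.< t → Coefficient i (K-terms e) s → s ≈ 0#
        K-coefficient≈0 = coefficient≈0
          (ρ<t ∷ ℕ.<-trans (ℕ.n<1+n ρ) ρ<t ∷ ρ′<t ∷ ℕ.<-trans (ℕ.n<1+n ρ′) ρ′<t ∷ 0<t ∷ e<t ∷ [])
          (K-relation e suc-e≡t)

        -- All degrees contributed by `g₊` and `g₋` lie strictly between 0 and `e = t - 1`. The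
        -- coefficients of degree 0 and `e` are therefore just `- c′` and `- d₂`, and the second row
        -- of the matrix vanishes.
        interior-degree⇒⊥ : ρ ≢ 0 → ρ′ ≢ 0 → ⊥
        interior-degree⇒⊥ ρ≢0 ρ′≢0 = det≈0-rows
          (-x+0≈0⇒x≈0 (K-coefficient≈0 0<t
            (miss (λ ()) (miss ρ≢0 (miss (λ ()) (miss ρ′≢0 (hit ≡.refl (miss e≢0 []))))))))
          (xy≈0⇒x≈0 2#≉0 (-x+0≈0⇒x≈0 (K-coefficient≈0 e<t
            (miss ρ≢e (miss (ℕ.<⇒≢ ρ<e) (miss ρ′≢e (miss (ℕ.<⇒≢ ρ′<e) (miss (λ 0≡e → e≢0 (≡.sym 0≡e)) (hit ≡.refl [])))))))))
          where
          e≢0 : e ≢ 0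
          e≢0 ≡.refl = ℕ.<⇒≱ 4<t (ℕ.≤-trans (ℕ.≤-reflexive (≡.sym suc-e≡t)) (ℕ.s≤s ℕ.z≤n))
          ρ<e : ρ ℕ.< e
          ρ<e = ℕ.s<s⁻¹ (≡.subst (suc ρ ℕ.<_) (≡.sym suc-e≡t) ρ<t)
          ρ′<e : ρ′ ℕ.< e
          ρ′<e = ℕ.s<s⁻¹ (≡.subst (suc ρ′ ℕ.<_) (≡.sym suc-e≡t) ρ′<t)
          e≡ : ρ ℕ.+ suc ρ′ ≡ e
          e≡ = ℕ.suc-injective (≡.trans sum (≡.sym suc-e≡t))
          ρ≢e : suc ρ ≢ e
          ρ≢e eq = ρ′≢0 (ℕ.+-cancelˡ-≡ (suc ρ) ρ′ 0 (≡.trans (≡.sym (ℕ.+-suc ρ ρ′)) (≡.trans e≡ (≡.trans (≡.sym eq) (≡.sym (ℕ.+-identityʳ (suc ρ)))))))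
          ρ′≢e : suc ρ′ ≢ e
          ρ′≢e eq = ρ≢0 (ℕ.+-cancelʳ-≡ (suc ρ′) ρ 0 (≡.trans e≡ (≡.sym eq)))

    -- Degrees 1 and t - 1; here t = 5 + κ keeps the degrees 0, ±1 and ±2 apart.
    module _ {κ : ℕ} (t≡5+κ : 5 ℕ.+ κ ≡ t) {g₊ g₋ : F → F}
      (hom₊ : Homogeneous 1 g₊) (hom₋ : Homogeneous (4 ℕ.+ κ) g₋)
      (eq : ∀ x → g₊ (a * x + b * phi q t m x) + g₋ (a * x + b * phi q t m x) ≈ c′ * x + d * phi q t m x)
      where
      open Homogeneous-parts hom₊ hom₋ eq

      private
        w μ : F
        w = proj₁ ∃V
        Vw = proj₁ (proj₂ ∃V)
        w≉0 = proj₂ (proj₂ ∃V)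
        μ = m * σ 1 w
        μ≉0 : ¬ μ ≈ 0#
        μ≉0 = *-≉0 m≉0 (σ-≉0 1 w≉0)
        Vμ : V μ
        Vμ = trans (σ-* t m (σ 1 w)) (trans (*-cong m∈K (V-σ 1 Vw)) (sym (-‿distribʳ-* m (σ 1 w))))

        <t : ∀ {i} → i ℕ.< 5 ℕ.+ κ → i ℕ.< t
        <t {i} = ≡.subst (i ℕ.<_) t≡5+κ

        -- On `V` the map `φ` sends `k * w` to `2 σ(k) μ`, so here the term with `b` has degree one
        -- more. For `g₋` that degree is `t`, which acts on `K` as degree 0.
        V-terms : List (ℕ × F)
        V-terms = (1 , g₊ (a * w)) ∷ (2 , g₊ (b₂ * μ)) ∷ (4 ℕ.+ κ , g₋ (a * w)) ∷ (0 , g₋ (b₂ * μ)) ∷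
          (0 , - (c′ * w)) ∷ (1 , - (d₂ * μ)) ∷ []

        V-relation : ∀ k → K k → evaluate V-terms k ≈ 0#
        V-relation k Kk = begin
          evaluate V-terms k
            ≈⟨ solve 12 (λ p₁ s₁ p₂ s₂ p₃ s₃ p₄ s₄ p₅ s₅ p₆ s₆ →
                 p₁ :* s₁ :+ (p₂ :* s₂ :+ (p₃ :* s₃ :+ (p₄ :* s₄ :+ (:- p₅ :* s₅ :+ (:- p₆ :* s₆ :+ con 0ℤ))))) :=
                 (s₁ :* p₁ :+ s₂ :* p₂) :+ (s₃ :* p₃ :+ s₄ :* p₄) :- (p₅ :* s₅ :+ p₆ :* s₆)) refl
                 (g₊ (a * w)) (σ 1 k) (g₊ (b₂ * μ)) (σ 2 k) (g₋ (a * w)) (σ (4 ℕ.+ κ) k) (g₋ (b₂ * μ)) (σ 0 k) (c′ * w) (σ 0 k) (d₂ * μ) (σ 1 k) ⟩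
          (σ 1 k * g₊ (a * w) + σ 2 k * g₊ (b₂ * μ)) + (σ (4 ℕ.+ κ) k * g₋ (a * w) + σ 0 k * g₋ (b₂ * μ)) - (c′ * w * σ 0 k + d₂ * μ * σ 1 k)
            ≈⟨ +-cong (+-cong (part 2 hom₊ (σ-∘ 1 1 k)) (part 0 hom₋ last-degree)) (-‿cong right) ⟩
          g₊ (a * (k * w) + b * phi q t m (k * w)) + g₋ (a * (k * w) + b * phi q t m (k * w)) - (c′ * (k * w) + d * phi q t m (k * w))
            ≈⟨ x≈y⇒x-y≈0 (eq (k * w)) ⟩
          0# ∎
          where
          V-kw : V (k * w)
          V-kw = trans (σ-* t k w) (trans (*-cong Kk Vw) (sym (-‿distribʳ-* k w)))
          phi-kw : phi q t m (k * w) ≈ 2# * (σ 1 k * μ)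
          phi-kw = trans (phi-V m V-kw) (*-congˡ (trans (*-congˡ (σ-* 1 k w))
            (solve 3 (λ m s w → m :* (s :* w) := s :* (m :* w)) refl m (σ 1 k) (σ 1 w))))
          argument : k * (a * w) + σ 1 k * (b₂ * μ) ≈ a * (k * w) + b * phi q t m (k * w)
          argument = trans (solve 7 (λ k a w s b z u → k :* (a :* w) :+ s :* (b :* z :* u) := a :* (k :* w) :+ b :* (z :* (s :* u))) refl k a w (σ 1 k) b 2# μ)
            (+-congˡ (*-congˡ (sym phi-kw)))
          last-degree : σ (4 ℕ.+ κ) (σ 1 k) ≈ σ 0 k
          last-degree = trans (σ-∘ (4 ℕ.+ κ) 1 k) (trans (σ-≡ (≡.trans (ℕ.+-comm (4 ℕ.+ κ) 1) t≡5+κ) k) (trans Kk (sym (σ-identity k))))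
          part : ∀ {r g} r′ → Homogeneous r g → σ r (σ 1 k) ≈ σ r′ k →
            σ r k * g (a * w) + σ r′ k * g (b₂ * μ) ≈ g (a * (k * w) + b * phi q t m (k * w))
          part {r} {g} r′ hom degree = begin
            σ r k * g (a * w) + σ r′ k * g (b₂ * μ)         ≈⟨ +-congˡ (*-congʳ degree) ⟨
            σ r k * g (a * w) + σ r (σ 1 k) * g (b₂ * μ)    ≈⟨ homogeneous-combination hom Kk (K-σ 1 Kk) ⟨
            g (k * (a * w) + σ 1 k * (b₂ * μ))              ≈⟨ Homogeneous.g-cong hom argument ⟩
            g (a * (k * w) + b * phi q t m (k * w))         ∎
          right : c′ * w * σ 0 k + d₂ * μ * σ 1 k ≈ c′ * (k * w) + d * phi q t m (k * w)
          right = +-cong (trans (*-congˡ (σ-identity k)) (solve 3 (λ c w k → c :* w :* k := c :* (k :* w)) refl c′ w k))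
            (trans (solve 4 (λ d z u s → d :* z :* u :* s := d :* (z :* (s :* u))) refl d 2# μ (σ 1 k)) (*-congˡ (sym phi-kw)))

        K-coeff : ∀ {i s} → i ℕ.< 5 ℕ.+ κ → Coefficient i (K-terms (4 ℕ.+ κ)) s → s ≈ 0#
        K-coeff i< = K-coefficient≈0 t≡5+κ (<t (ℕ.n<1+n (4 ℕ.+ κ))) t≡5+κ (<t i<)

        V-coeff : ∀ {i s} → i ℕ.< 5 ℕ.+ κ → Coefficient i V-terms s → s ≈ 0#
        V-coeff i< = coefficient≈0 (<t 1< ∷ <t 2< ∷ <t (ℕ.n<1+n (4 ℕ.+ κ)) ∷ 0<t ∷ 0<t ∷ <t 1< ∷ []) V-relation (<t i<)
          where
          1< : 1 ℕ.< 5 ℕ.+ κ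
          1< = ℕ.s<s ℕ.z<s
          2< : 2 ℕ.< 5 ℕ.+ κ
          2< = ℕ.s<s 1<′
            where
            1<′ : 1 ℕ.< 4 ℕ.+ κ
            1<′ = ℕ.s<s ℕ.z<s

        -- The four equations on `K` come from the degrees 1, 0, `t - 1` and `t - 2`, the four on
        -- `V` from 1, 2, `t - 1` and 0.
        g₊a≈0 : g₊ a ≈ 0#
        g₊a≈0 = x+0≈0⇒x≈0 (K-coeff (ℕ.s<s ℕ.z<s)
          (hit ≡.refl (miss (λ ()) (miss (λ ()) (miss (λ ()) (miss (λ ()) (miss (λ ()) [])))))))
        g₊b₂≈c : g₊ b₂ ≈ c′
        g₊b₂≈c = x+[-y+0]≈0⇒x≈y (K-coeff ℕ.z<s
          (miss (λ ()) (hit ≡.refl (miss (λ ()) (miss (λ ()) (hit ≡.refl (miss (λ ()) [])))))))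
        g₋a≈d₂ : g₋ a ≈ d₂
        g₋a≈d₂ = x+[-y+0]≈0⇒x≈y (K-coeff (ℕ.n<1+n (4 ℕ.+ κ))
          (miss (λ ()) (miss (λ ()) (hit ≡.refl (miss (ℕ.<⇒≢ (ℕ.n<1+n (3 ℕ.+ κ))) (miss (λ ()) (hit ≡.refl [])))))))
        g₋b₂≈0 : g₋ b₂ ≈ 0#
        g₋b₂≈0 = x+0≈0⇒x≈0 (K-coeff (ℕ.<-trans (ℕ.n<1+n (3 ℕ.+ κ)) (ℕ.n<1+n (4 ℕ.+ κ)))
          (miss (λ ()) (miss (λ ()) (miss (ℕ.>⇒≢ (ℕ.n<1+n (3 ℕ.+ κ))) (hit ≡.refl (miss (λ ()) (miss (ℕ.>⇒≢ (ℕ.n<1+n (3 ℕ.+ κ))) [])))))))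
        g₊aw≈d₂μ : g₊ (a * w) ≈ d₂ * μ
        g₊aw≈d₂μ = x+[-y+0]≈0⇒x≈y (V-coeff (ℕ.s<s ℕ.z<s)
          (hit ≡.refl (miss (λ ()) (miss (λ ()) (miss (λ ()) (miss (λ ()) (hit ≡.refl [])))))))
        g₊b₂μ≈0 : g₊ (b₂ * μ) ≈ 0#
        g₊b₂μ≈0 = x+0≈0⇒x≈0 (V-coeff (ℕ.s<s (ℕ.s<s ℕ.z<s))
          (miss (λ ()) (hit ≡.refl (miss (λ ()) (miss (λ ()) (miss (λ ()) (miss (λ ()) [])))))))
        g₋aw≈0 : g₋ (a * w) ≈ 0#
        g₋aw≈0 = x+0≈0⇒x≈0 (V-coeff (ℕ.n<1+n (4 ℕ.+ κ))
          (miss (λ ()) (miss (λ ()) (hit ≡.refl (miss (λ ()) (miss (λ ()) (miss (λ ()) [])))))))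
        g₋b₂μ≈cw : g₋ (b₂ * μ) ≈ c′ * w
        g₋b₂μ≈cw = x+[-y+0]≈0⇒x≈y (V-coeff ℕ.z<s
          (miss (λ ()) (miss (λ ()) (miss (λ ()) (hit ≡.refl (hit ≡.refl (miss (λ ()) [])))))))

      injective₊⇒⊥ : Injective₀ g₊ → ⊥
      injective₊⇒⊥ inj = det≈0-columns (inj a g₊a≈0)
        (b₂≈0⇒b≈0 (xy≈0⇒x≈0 μ≉0 (inj (b₂ * μ) g₊b₂μ≈0)))

      injective₋⇒⊥ : Injective₀ g₋ → ⊥
      injective₋⇒⊥ inj = det≈0-columns (xy≈0⇒x≈0 w≉0 (inj (a * w) g₋aw≈0)) (b₂≈0⇒b≈0 (inj b₂ g₋b₂≈0))

      -- If `a ≠ 0`, then `a` is a zero of `g₊` and `a * w` one of `g₋`, so the norm of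
      -- `g₊ (a * w) = g₋ a * μ` reads `N(2aw) = N(2a) N(μ)`, where `N μ = N m * N w`. If `a = 0`,
      -- the same argument applies to `b₂` and `μ` through `g₋ (b₂ * μ) = g₊ b₂ * w`.
      balanced⇒⊥ : Balanced g₊ → Balanced g₋ → ⊥
      balanced⇒⊥ bal₊ bal₋ with a ≟ 0#
      ... | no a≉0 = Nm≉1 (*-cancelˡ (*-≉0 (N-≉0 2a≉0) (N-≉0 w≉0)) (begin
          N (2# * a) * N w * N m          ≈⟨ solve 3 (λ p w m → p :* w :* m := p :* (m :* w)) refl (N (2# * a)) (N w) (N m) ⟩
          N (2# * a) * (N m * N w)        ≈⟨ *-cong (trans (sym (proj₂ (bal₋ a w a≉0 Vw w≉0) g₋aw≈0)) (N-cong g₋a≈d₂)) (sym Nμ) ⟩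
          N d₂ * N μ                      ≈⟨ N-* d₂ μ ⟨
          N (d₂ * μ)                      ≈⟨ N-cong g₊aw≈d₂μ ⟨
          N (g₊ (a * w))                  ≈⟨ proj₁ (bal₊ a w a≉0 Vw w≉0) g₊a≈0 ⟩
          N (2# * (a * w))                ≈⟨ N-cong (*-assoc 2# a w) ⟨
          N (2# * a * w)                  ≈⟨ N-* (2# * a) w ⟩
          N (2# * a) * N w                ≈⟨ *-identityʳ (N (2# * a) * N w) ⟨
          N (2# * a) * N w * 1#           ∎))
        where
        2a≉0 = *-≉0 2#≉0 a≉0
        Nμ : N μ ≈ N m * N w
        Nμ = trans (N-* m (σ 1 w)) (*-congˡ (N-σ 1 w≉0))
      ... | yes a≈0 = Nm≉1 (*-cancelˡ (*-≉0 (N-≉0 2b₂≉0) (N-≉0 w≉0)) (begin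
          N (2# * b₂) * N w * N m         ≈⟨ solve 3 (λ p w m → p :* w :* m := p :* (m :* w)) refl (N (2# * b₂)) (N w) (N m) ⟩
          N (2# * b₂) * (N m * N w)       ≈⟨ *-congˡ Nμ ⟨
          N (2# * b₂) * N μ               ≈⟨ N-* (2# * b₂) μ ⟨
          N (2# * b₂ * μ)                 ≈⟨ N-cong (*-assoc 2# b₂ μ) ⟩
          N (2# * (b₂ * μ))               ≈⟨ proj₁ (bal₋ b₂ μ b₂≉0 Vμ μ≉0) g₋b₂≈0 ⟨
          N (g₋ (b₂ * μ))                 ≈⟨ N-cong g₋b₂μ≈cw ⟩
          N (c′ * w)                      ≈⟨ N-* c′ w ⟩
          N c′ * N w                      ≈⟨ *-congʳ (trans (sym (N-cong g₊b₂≈c)) (proj₂ (bal₊ b₂ μ b₂≉0 Vμ μ≉0) g₊b₂μ≈0)) ⟩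
          N (2# * b₂) * N w               ≈⟨ *-identityʳ (N (2# * b₂) * N w) ⟨
          N (2# * b₂) * N w * 1#          ∎))
        where
        b₂≉0 : ¬ b₂ ≈ 0#
        b₂≉0 eq = det≈0-columns a≈0 (b₂≈0⇒b≈0 eq)
        2b₂≉0 = *-≉0 2#≉0 b₂≉0
        Nμ : N μ ≈ N m * N w
        Nμ = trans (N-* m (σ 1 w)) (*-congˡ (N-σ 1 w≉0))

    Excluded : (g₊ g₋ : F → F) → Set (c ⊔ ℓ)
    Excluded g₊ g₋ = Injective₀ g₊ ⊎ (Balanced g₊ × Balanced g₋)

    private
      extreme-degree : ∀ {ρ} → 2 ℕ.+ ρ ≡ t → ∃ λ κ → 3 ℕ.+ κ ≡ ρ
      extreme-degree sum = ℕ.m≤n⇒∃[o]m+o≡n (ℕ.s≤s⁻¹ (ℕ.s≤s⁻¹ (≡.subst (5 ℕ.≤_) (≡.sym sum) 4<t)))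

    -- If `ρ′ = 0`, the two parts are exchanged, and the part assumed injective then stands in
    -- second place.
    no-homogeneous-parts : ∀ {ρ ρ′ g₊ g₋} → suc ρ ℕ.+ suc ρ′ ≡ t →
      Homogeneous (suc ρ) g₊ → Homogeneous (suc ρ′) g₋ → Excluded g₊ g₋ →
      (∀ x → g₊ (a * x + b * phi q t m x) + g₋ (a * x + b * phi q t m x) ≈ c′ * x + d * phi q t m x) → ⊥
    no-homogeneous-parts {zero} {ρ′} sum hom₊ hom₋ excluded eq with extreme-degree sum
    ... | κ , ≡.refl with excluded
    ...   | inj₁ inj           = injective₊⇒⊥ sum hom₊ hom₋ eq inj
    ...   | inj₂ (bal₊ , bal₋) = balanced⇒⊥ sum hom₊ hom₋ eq bal₊ bal₋
    no-homogeneous-parts {suc ρ} {zero} sum hom₊ hom₋ excluded eq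
      with extreme-degree {suc ρ} (≡.trans (ℕ.+-comm 1 (2 ℕ.+ ρ)) sum)
    ... | κ , ≡.refl with excluded
    ...   | inj₁ inj           = injective₋⇒⊥ (≡.trans (ℕ.+-comm 1 (2 ℕ.+ ρ)) sum) hom₋ hom₊ (λ x → trans (+-comm _ _) (eq x)) inj
    ...   | inj₂ (bal₊ , bal₋) = balanced⇒⊥ (≡.trans (ℕ.+-comm 1 (2 ℕ.+ ρ)) sum) hom₋ hom₊ (λ x → trans (+-comm _ _) (eq x)) bal₋ bal₊
    no-homogeneous-parts {suc ρ} {suc ρ′} sum hom₊ hom₋ excluded eq =
      Homogeneous-parts.interior-degree⇒⊥ hom₊ hom₋ eq 1+[t-1]
        (≡.subst (t ℕ.∸ 1 ℕ.<_) 1+[t-1] (ℕ.n<1+n (t ℕ.∸ 1))) sum (λ ()) (λ ())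

  -- The families as sums of two homogeneous parts

  instance
    t-nonZero : ℕ.NonZero t
    t-nonZero = ℕ.>-nonZero 0<t

  σ-injective₀ : ∀ {z} r → ¬ z ≈ 0# → Injective₀ (λ x → z * σ r x)
  σ-injective₀ r z≉0 y eq = σ-≈0 r (xy≈0⇒y≈0 z≉0 eq)

  -- With `A = σ e y` and `B = z * σ e′ y`, the value at `y` is `A + B` and, by the sign on `V`, the
  -- value at `y * w` is `(A - B) * σ e w`. When one of `A + B` and `A - B` vanishes, the other
  -- equals `2 A`.
  balanced : ∀ e e′ z → (∀ {w} → V w → σ e′ w ≈ - σ e w) → Balanced (λ x → σ e x + z * σ e′ x)
  balanced e e′ z σe′≈-σe y w y≉0 Vw w≉0 = first , second
    where
    A = σ e y
    B = z * σ e′ y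
    twisted : σ e (y * w) + z * σ e′ (y * w) ≈ (A - B) * σ e w
    twisted = begin
      σ e (y * w) + z * σ e′ (y * w)                ≈⟨ +-cong (σ-* e y w) (*-congˡ (trans (σ-* e′ y w) (*-congˡ (σe′≈-σe Vw)))) ⟩
      A * σ e w + z * (σ e′ y * - σ e w)            ≈⟨ solve 4 (λ a z b s → a :* s :+ z :* (b :* (:- s)) := (a :- z :* b) :* s) refl A z (σ e′ y) (σ e w) ⟩
      (A - B) * σ e w                               ∎
    N-2 : ∀ {x} → ¬ x ≈ 0# → N (2# * σ e x) ≈ N (2# * x)
    N-2 {x} x≉0 = trans (N-* 2# (σ e x)) (trans (*-congˡ (N-σ e x≉0)) (sym (N-* 2# x)))
    doubled : ∀ {a b} → a - b ≈ 0# → a + b ≈ 2# * a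
    doubled {a} {b} eq = begin
      a + b                 ≈⟨ solve 2 (λ a b → a :+ b := (con 1ℤ :+ con 1ℤ) :* a :- (a :- b)) refl a b ⟩
      2# * a - (a - b)      ≈⟨ +-congˡ (-‿cong eq) ⟩
      2# * a - 0#           ≈⟨ solve 1 (λ a → a :- con 0ℤ := a) refl (2# * a) ⟩
      2# * a                ∎
    A-B : A + B ≈ 0# → A - B ≈ 2# * A
    A-B eq = doubled (trans (+-congˡ (solve 1 (λ b → :- (:- b) := b) refl B)) eq)
    first : A + B ≈ 0# → N (σ e (y * w) + z * σ e′ (y * w)) ≈ N (2# * (y * w))
    first eq = trans (N-cong (begin
      σ e (y * w) + z * σ e′ (y * w)    ≈⟨ twisted ⟩
      (A - B) * σ e w                   ≈⟨ *-congʳ (A-B eq) ⟩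
      2# * A * σ e w                    ≈⟨ *-assoc 2# A (σ e w) ⟩
      2# * (A * σ e w)                  ≈⟨ *-congˡ (σ-* e y w) ⟨
      2# * σ e (y * w)                  ∎)) (N-2 (*-≉0 y≉0 w≉0))
    second : σ e (y * w) + z * σ e′ (y * w) ≈ 0# → N (A + B) ≈ N (2# * y)
    second eq = trans (N-cong (doubled (xy≈0⇒x≈0 (σ-≉0 e w≉0) (trans (sym twisted) eq)))) (N-2 y≉0)

  σ-*2t : ∀ i x → σ (i ℕ.* (2 ℕ.* t)) x ≈ x
  σ-*2t zero    x = σ-identity x
  σ-*2t (suc i) x = trans (sym (σ-∘ (2 ℕ.* t) (i ℕ.* (2 ℕ.* t)) x))
    (trans (σ-cong (2 ℕ.* t) (σ-*2t i x)) (pow-cardinality x))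

  module _ (s : ℕ) (coprime : gcd s (2 ℕ.* t) ≡ 1) where

    s≡1+[s/2]*2 : s ≡ 1 ℕ.+ s / 2 ℕ.* 2
    s≡1+[s/2]*2 = ≡.trans (m≡m%n+[m/n]*n s 2) (≡.cong (ℕ._+ s / 2 ℕ.* 2)
      (parity (s % 2) (m%n<n s 2) (λ eq → coprime⇒∤ coprime (∣.m∣m*n t) (ℕ.n<1+n 1) (∣.m%n≡0⇒n∣m s 2 eq))))
      where
      parity : ∀ r → r ℕ.< 2 → r ≢ 0 → r ≡ 1
      parity 0 _ r≢0 = contradiction ≡.refl r≢0
      parity 1 _ _   = ≡.refl
      parity (suc (suc _)) (ℕ.s≤s (ℕ.s≤s ())) _

    -- `σ (s * t)` is conjugation iterated `s` times, and `s` is odd because it is prime to `2t`.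
    σ-st-V : ∀ {w} → V w → σ (s ℕ.* t) w ≈ - w
    σ-st-V {w} Vw = begin
      σ (s ℕ.* t) w                                ≈⟨ σ-≡ st≡ w ⟩
      σ (t ℕ.+ s / 2 ℕ.* (2 ℕ.* t)) w              ≈⟨ σ-∘ t (s / 2 ℕ.* (2 ℕ.* t)) w ⟨
      conj (σ (s / 2 ℕ.* (2 ℕ.* t)) w)             ≈⟨ σ-cong t (σ-*2t (s / 2) w) ⟩
      conj w                                       ≈⟨ Vw ⟩
      - w                                          ∎
      where
      st≡ : s ℕ.* t ≡ t ℕ.+ s / 2 ℕ.* (2 ℕ.* t)
      st≡ = ≡.trans (≡.cong (ℕ._* t) s≡1+[s/2]*2) (≡.cong (t ℕ.+_) (ℕ.*-assoc (s / 2) 2 t))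

    -- Reduction of the degrees modulo `t`: as `s` is prime to `2t`, its residue is nonzero, and `e`
    -- is congruent to the complementary residue.
    no-parts : ∀ a b c′ d {m} → K m → ¬ m ≈ 0# → ¬ N m ≈ 1# → ¬ a * d - b * c′ ≈ 0# →
      ∀ {e j g₊ g₋} → s ℕ.+ e ≡ j ℕ.* t → Homogeneous s g₊ → Homogeneous e g₋ →
      Injective₀ g₊ ⊎ (Balanced g₊ × Balanced g₋) →
      ¬ (∀ x → g₊ (a * x + b * phi q t m x) + g₋ (a * x + b * phi q t m x) ≈ c′ * x + d * phi q t m x)
    no-parts a b c′ d Km m≉0 Nm≉1 det≉0 {e} {j} {g₊} {g₋} s+e≡jt hom₊ hom₋ excluded eq =
      no-homogeneous-parts a b c′ d Km m≉0 Nm≉1 det≉0 sum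
        (regrade (λ k Kk → trans (σ-≡ s≡ k) (σ-+*t (suc ρ) (s / t) k Kk)) hom₊)
        (regrade (σ-complement s j (suc (s / t)) s+e≡jt s+r′≡) hom₋)
        excluded eq
      where
      r≢0 : s % t ≢ 0
      r≢0 eq = coprime⇒∤ coprime (∣.n∣m*n 2) (ℕ.<-trans (ℕ.s<s ℕ.z<s) 4<t) (∣.m%n≡0⇒n∣m s t eq)
      ρ ρ′ : ℕ
      ρ = ℕ.pred (s % t)
      ρ′ = ℕ.pred (t ℕ.∸ s % t)
      suc-ρ : suc ρ ≡ s % t
      suc-ρ = ℕ.suc-pred (s % t) {{ℕ.≢-nonZero r≢0}}
      suc-ρ′ : suc ρ′ ≡ t ℕ.∸ s % t
      suc-ρ′ = ℕ.suc-pred (t ℕ.∸ s % t) {{ℕ.>-nonZero (ℕ.m<n⇒0<n∸m (m%n<n s t))}}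
      sum : suc ρ ℕ.+ suc ρ′ ≡ t
      sum = ≡.trans (≡.cong₂ ℕ._+_ suc-ρ suc-ρ′) (ℕ.m+[n∸m]≡n (ℕ.<⇒≤ (m%n<n s t)))
      s≡ : s ≡ suc ρ ℕ.+ s / t ℕ.* t
      s≡ = ≡.trans (m≡m%n+[m/n]*n s t) (≡.cong (ℕ._+ s / t ℕ.* t) (≡.sym suc-ρ))
      s+r′≡ : s ℕ.+ suc ρ′ ≡ suc (s / t) ℕ.* t
      s+r′≡ = ≡.trans (≡.cong (ℕ._+ suc ρ′) (≡.trans s≡ (ℕ.+-comm (suc ρ) (s / t ℕ.* t))))
        (≡.trans (ℕ.+-assoc (s / t ℕ.* t) (suc ρ) (suc ρ′)) (≡.trans (≡.cong (s / t ℕ.* t ℕ.+_) sum) (ℕ.+-comm (s / t ℕ.* t) t)))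

  s+s[t-1] : ∀ s → s ℕ.+ s ℕ.* (t ℕ.∸ 1) ≡ s ℕ.* t
  s+s[t-1] s = ≡.trans (≡.sym (ℕ.*-suc s (t ℕ.∸ 1))) (≡.cong (s ℕ.*_) 1+[t-1])

  s[t+1] : ∀ s → s ℕ.* (t ℕ.+ 1) ≡ s ℕ.+ s ℕ.* t
  s[t+1] s = ≡.trans (≡.cong (s ℕ.*_) (ℕ.+-comm t 1)) (ℕ.*-suc s t)

  s[2t-1] : ∀ s → s ℕ.* (2 ℕ.* t ℕ.∸ 1) ≡ s ℕ.* (t ℕ.∸ 1) ℕ.+ s ℕ.* t
  s[2t-1] s = ≡.trans (≡.cong (s ℕ.*_) (≡.trans (≡.cong (λ k → t ℕ.+ k ℕ.∸ 1) (ℕ.+-identityʳ t)) (ℕ.+-∸-comm t 0<t)))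
    (ℕ.*-distribˡ-+ s (t ℕ.∸ 1) t)

  -- Field automorphisms and inequivalence with the three families

  phi-cong : ∀ m {x y} → x ≈ y → phi q t m x ≈ phi q t m y
  phi-cong m x≈y = +-cong (+-cong (σ-cong (t ℕ.∸ 1) x≈y) (σ-cong (2 ℕ.* t ℕ.∸ 1) x≈y))
    (*-congˡ (+-cong (σ-cong 1 x≈y) (-‿cong (σ-cong (t ℕ.+ 1) x≈y))))

  module _ {τ : F → F} (aut : IsFieldAut τ) where
    private
      τ-cong = proj₁ aut
      τ-+ = proj₁ (proj₂ aut)
      τ-* = proj₁ (proj₂ (proj₂ aut))
      τ-1 = proj₁ (proj₂ (proj₂ (proj₂ aut)))
      τ-injective = proj₁ (proj₂ (proj₂ (proj₂ (proj₂ aut))))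

    τ-0 : τ 0# ≈ 0#
    τ-0 = +-cancelˡ (τ 0#) _ _ (trans (sym (τ-+ 0# 0#)) (trans (τ-cong _ _ (+-identityˡ 0#)) (sym (+-identityʳ (τ 0#)))))

    τ-- : ∀ x y → τ (x - y) ≈ τ x - τ y
    τ-- x y = trans (τ-+ x (- y)) (+-congˡ (+-inverseˡ-unique _ _
      (trans (sym (τ-+ (- y) y)) (trans (τ-cong _ _ (-‿inverseˡ y)) τ-0))))

    τ-pow : ∀ x n → τ (pow x n) ≈ pow (τ x) n
    τ-pow x zero    = τ-1
    τ-pow x (suc n) = trans (τ-* x (pow x n)) (*-congˡ (τ-pow x n))

    -- An automorphism commutes with powers, so its effect is absorbed into the parameter; the next
    -- lemmas carry the conditions on `m` over to `τ m`.
    τ-phi : ∀ m x → τ (phi q t m x) ≈ phi q t (τ m) (τ x)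
    τ-phi m x = trans (τ-+ _ _) (+-cong
      (trans (τ-+ _ _) (+-cong (τ-pow x (q ℕ.^ (t ℕ.∸ 1))) (τ-pow x (q ℕ.^ (2 ℕ.* t ℕ.∸ 1)))))
      (trans (τ-* _ _) (*-congˡ (trans (τ-- _ _) (+-cong (τ-pow x (q ℕ.^ 1)) (-‿cong (τ-pow x (q ℕ.^ (t ℕ.+ 1)))))))))

    τ-K : ∀ {m} → K m → K (τ m)
    τ-K {m} Km = trans (sym (τ-pow m (q ℕ.^ t))) (τ-cong _ _ Km)

    τ-≉0 : ∀ {m} → ¬ m ≈ 0# → ¬ τ m ≈ 0#
    τ-≉0 m≉0 eq = m≉0 (τ-injective _ _ (trans eq (sym τ-0)))

    τ-N≉1 : ∀ {m} → ¬ N m ≈ 1# → ¬ N (τ m) ≈ 1#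
    τ-N≉1 {m} Nm≉1 eq = Nm≉1 (τ-injective _ _ (trans (τ-pow m (normExp q (2 ℕ.* t))) (trans eq (sym τ-1))))

  module _ {m : F} (Km : K m) (m≉0 : ¬ m ≈ 0#) (Nm≉1 : ¬ N m ≈ 1#) where

    module Equivalence {g : F → F} (equivalent : Equivalent (phi q t m) g) where
      a = proj₁ equivalent
      b = proj₁ (proj₂ equivalent)
      c′ = proj₁ (proj₂ (proj₂ equivalent))
      d = proj₁ (proj₂ (proj₂ (proj₂ equivalent)))
      τ = proj₁ (proj₂ (proj₂ (proj₂ (proj₂ equivalent))))
      det≉0 = proj₁ (proj₂ (proj₂ (proj₂ (proj₂ (proj₂ equivalent)))))
      aut = proj₁ (proj₂ (proj₂ (proj₂ (proj₂ (proj₂ (proj₂ equivalent))))))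
      into = proj₁ (proj₂ (proj₂ (proj₂ (proj₂ (proj₂ (proj₂ (proj₂ equivalent)))))))

      m′ : F
      m′ = τ m

      argument : F → F
      argument x = a * x + b * phi q t m′ x

      -- Every `x` has the form `τ z`, so the point of the graph obtained from `z` becomes an
      -- identity in `x`. `G` is an explicit form of `g` that is known to respect the equality of
      -- the field.
      graph : ∀ {G : F → F} → (∀ {x y} → x ≈ y → G x ≈ G y) → (∀ x → g x ≈ G x) →
        ∀ x → G (argument x) ≈ c′ * x + d * phi q t m′ x
      graph {G} G-cong g≈G x = begin
        G (argument x)                        ≈⟨ G-cong (+-cong (*-congˡ τz≈x) (*-congˡ τφz≈)) ⟨
        G (a * τ z + b * τ (phi q t m z))     ≈⟨ G-cong (proj₁ (proj₂ (into z))) ⟩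
        G y                                   ≈⟨ g≈G y ⟨
        g y                                   ≈⟨ proj₂ (proj₂ (into z)) ⟨
        c′ * τ z + d * τ (phi q t m z)        ≈⟨ +-cong (*-congˡ τz≈x) (*-congˡ τφz≈) ⟩
        c′ * x + d * phi q t m′ x             ∎
        where
        preimage = proj₂ (proj₂ (proj₂ (proj₂ (proj₂ aut)))) x
        z = proj₁ preimage
        τz≈x = proj₂ preimage
        y = proj₁ (into z)
        τφz≈ : τ (phi q t m z) ≈ phi q t m′ x
        τφz≈ = trans (τ-phi aut m z) (phi-cong m′ τz≈x)

      -- The second row may be replaced by one that gives the same determinant; this makes room for
      -- a shear.
      inequivalent : ∀ s → gcd s (2 ℕ.* t) ≡ 1 → ∀ c″ d″ → a * d″ - b * c″ ≈ a * d - b * c′ →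
        ∀ {e} j {g₊ g₋} → s ℕ.+ e ≡ j ℕ.* t → Homogeneous s g₊ → Homogeneous e g₋ →
        Injective₀ g₊ ⊎ (Balanced g₊ × Balanced g₋) →
        ¬ (∀ x → g₊ (argument x) + g₋ (argument x) ≈ c″ * x + d″ * phi q t m′ x)
      inequivalent s coprime c″ d″ det≈ j =
        no-parts s coprime a b c″ d″ (τ-K aut Km) (τ-≉0 aut m≉0) (τ-N≉1 aut Nm≉1)
          (λ eq → det≉0 (trans (sym det≈) eq)) {j = j}

    phi-≁-pseudoregulus : ∀ g → Equivalent (phi q t m) g → ¬ PseudoregulusType q (2 ℕ.* t) g
    phi-≁-pseudoregulus g equivalent (s , coprime , g≈) =
      inequivalent s coprime c′ d refl s (s+s[t-1] s)
        -- The monomial is the injective part; the zero map completes it in the complementary degree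
        -- `s (t - 1)`.
        (*-homogeneous 1# (σ-homogeneous s)) (zero-homogeneous (s ℕ.* (t ℕ.∸ 1))) (inj₁ (σ-injective₀ s 1≉0))
        (graph (λ x≈y → +-congʳ (*-congˡ (σ-cong s x≈y)))
          (λ x → trans (g≈ x) (sym (trans (+-identityʳ _) (*-identityˡ (σ s x))))))
      where open Equivalence equivalent

    phi-≁-LP : ∀ g → Equivalent (phi q t m) g → ¬ LPType q (2 ℕ.* t) g
    phi-≁-LP g equivalent (s , δ , coprime , Nδ≉0 , _ , g≈) = split (s ℕ.≤? 2 ℕ.* t)
      where
      open Equivalence equivalent
      n = 2 ℕ.* t
      0<n : 0 ℕ.< n
      0<n = ℕ.≤-trans 0<t (ℕ.m≤m+n t (t ℕ.+ 0))
      δ≉0 : ¬ δ ≈ 0#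
      δ≉0 δ≈0 = Nδ≉0 (pow-≈0 (normExp q n) (normExp>0 q n 0<n))
        where
        pow-≈0 : ∀ k → 0 ℕ.< k → pow δ k ≈ 0#
        pow-≈0 (suc k) _ = trans (*-congʳ δ≈0) (zeroˡ (pow δ k))
      hom₊ : Homogeneous s (λ x → δ * σ s x)
      hom₊ = *-homogeneous δ (σ-homogeneous s)
      split : Dec (s ℕ.≤ n) → ⊥
      -- The term with `δ` is taken as the injective part; the exponents `s` and `n - s` add up to
      -- `2t`, whence the multiplier 2.
      split (yes s≤n) = inequivalent s coprime c′ d refl 2 (ℕ.m+[n∸m]≡n s≤n)
        hom₊ (σ-homogeneous (n ℕ.∸ s)) (inj₁ (σ-injective₀ s δ≉0))
        (graph (λ x≈y → +-cong (*-congˡ (σ-cong s x≈y)) (σ-cong (n ℕ.∸ s) x≈y))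
          (λ x → trans (g≈ x) (+-comm _ _)))
      -- For s > n the exponent n ∸ s is 0, and a shear removes the summand X.
      split (no s≰n) = inequivalent s coprime (c′ - a) (d - b)
        (solve 4 (λ a b c d → a :* (d :- b) :- b :* (c :- a) := a :* d :- b :* c) refl a b c′ d) s (s+s[t-1] s)
        hom₊ (zero-homogeneous (s ℕ.* (t ℕ.∸ 1))) (inj₁ (σ-injective₀ s δ≉0))
        (λ x → let y = argument x in begin
          δ * σ s y + 0#                                   ≈⟨ solve 2 (λ p y → p :+ con 0ℤ := (y :+ p) :- y) refl (δ * σ s y) y ⟩
          (y + δ * σ s y) - y                              ≈⟨ +-congʳ (graph (λ x≈y → +-cong x≈y (*-congˡ (σ-cong s x≈y))) g≈′ x) ⟩
          (c′ * x + d * phi q t m′ x) - y                  ≈⟨ solve 6 (λ a b c d x p → (c :* x :+ d :* p) :- (a :* x :+ b :* p) := (c :- a) :* x :+ (d :- b) :* p)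
                                                                refl a b c′ d x (phi q t m′ x) ⟩
          (c′ - a) * x + (d - b) * phi q t m′ x            ∎)
        where
        g≈′ : ∀ x → g x ≈ x + δ * σ s x
        g≈′ x = trans (g≈ x) (+-congʳ (trans (σ-≡ (ℕ.m≤n⇒m∸n≡0 (ℕ.<⇒≤ (ℕ.≰⇒> s≰n))) x) (σ-identity x)))

    phi-≁-psi : ∀ g → Equivalent (phi q t m) g → ¬ PsiType q t g
    phi-≁-psi g equivalent (s , h , h⁻¹ , coprime , _ , _ , g≈) =
      inequivalent s coprime c′ d refl s (s+s[t-1] s)
        -- The four terms are grouped by exponent modulo `t`: `s` with `s (t + 1)`, and `s (t - 1)`
        -- with `s (2t - 1)`.
        (+-homogeneous (σ-homogeneous s) (*-homogeneous z₊ (regrade (degree₊) (σ-homogeneous (s ℕ.* (t ℕ.+ 1))))))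
        (+-homogeneous (σ-homogeneous (s ℕ.* (t ℕ.∸ 1))) (*-homogeneous z₋ (regrade degree₋ (σ-homogeneous (s ℕ.* (2 ℕ.* t ℕ.∸ 1))))))
        (inj₂ (balanced s (s ℕ.* (t ℕ.+ 1)) z₊ (twist (s[t+1] s)) ,
               balanced (s ℕ.* (t ℕ.∸ 1)) (s ℕ.* (2 ℕ.* t ℕ.∸ 1)) z₋ (twist (s[2t-1] s))))
        (graph (λ x≈y → +-cong (+-cong (σ-cong s x≈y) (*-congˡ (σ-cong (s ℕ.* (t ℕ.+ 1)) x≈y)))
                               (+-cong (σ-cong (s ℕ.* (t ℕ.∸ 1)) x≈y) (*-congˡ (σ-cong (s ℕ.* (2 ℕ.* t ℕ.∸ 1)) x≈y))))
          (λ x → trans (g≈ x) (solve 4 (λ a b c d → a :+ b :+ c :+ d := (a :+ c) :+ (b :+ d)) refl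
            (σ s x) (σ (s ℕ.* (t ℕ.∸ 1)) x) (z₊ * σ (s ℕ.* (t ℕ.+ 1)) x) (z₋ * σ (s ℕ.* (2 ℕ.* t ℕ.∸ 1)) x))))
      where
      open Equivalence equivalent
      z₊ z₋ : F
      z₊ = pow h (1 ℕ.+ q ℕ.^ s)
      z₋ = h * pow h⁻¹ (q ℕ.^ (s ℕ.* (2 ℕ.* t ℕ.∸ 1)))
      degree₊ : ∀ k → K k → σ (s ℕ.* (t ℕ.+ 1)) k ≈ σ s k
      degree₊ k Kk = trans (σ-≡ (s[t+1] s) k) (σ-+*t s s k Kk)
      degree₋ : ∀ k → K k → σ (s ℕ.* (2 ℕ.* t ℕ.∸ 1)) k ≈ σ (s ℕ.* (t ℕ.∸ 1)) k
      degree₋ k Kk = trans (σ-≡ (s[2t-1] s) k) (σ-+*t (s ℕ.* (t ℕ.∸ 1)) s k Kk)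
      -- Within each group the exponents differ by `s * t`, which acts on `V` as a change of sign.
      twist : ∀ {e e′} → e′ ≡ e ℕ.+ s ℕ.* t → ∀ {w} → V w → σ e′ w ≈ - σ e w
      twist {e} e′≡ {w} Vw = trans (σ-≡ e′≡ w) (trans (sym (σ-∘ e (s ℕ.* t) w))
        (trans (σ-cong e (σ-st-V s coprime Vw)) (σ-neg e w)))

-- Assembly for the chosen `m`

open import Data.Nat using (_<_; _*_)

theorem4p7 : ∀ {c ℓ : Level} (q t : ℕ) → IsPrimePower q → IsOdd q → 4 < t →
    ((t % 2 ≡ 0 × 3 < q) ⊎ (t % 2 ≡ 1 × 5 < q)) →
    (R : CommutativeRing c ℓ) →
    FieldNotions.IsField R → FieldNotions.HasCardinality R (q Data.Nat.^ (2 * t)) →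
    Σ (CommutativeRing.Carrier R) λ m →
    FieldNotions.InSubfield R q t m ×
    FieldNotions.Scattered R q (FieldNotions.phi R q t m) ×
    (∀ g → FieldNotions.Equivalent R (FieldNotions.phi R q t m) g →
    ¬ FieldNotions.PseudoregulusType R q (2 * t) g ×
    ¬ FieldNotions.LPType R q (2 * t) g ×
    ¬ FieldNotions.PsiType R q t g)
theorem4p7 q t primePower odd 4<t parity R isField card =
  -- The numerical estimates concern `suc (l * 2)`; they are transported to `q` along `q≡` with
  -- `l = q / 2`.
  let m , Km , m≉0 , Nm≉1 , avoided = parameter (≡.subst
        (λ q → (t % 2 ≡ 0 × 3 < q) ⊎ (t % 2 ≡ 1 × 5 < q) → Exponents q t) (≡.sym q≡) (exponents (q / 2) t 0<t) parity)
  in m , Km , phi-scattered Km m≉0 Nm≉1 avoided , λ g equivalent →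
       phi-≁-pseudoregulus Km m≉0 Nm≉1 g equivalent ,
       phi-≁-LP Km m≉0 Nm≉1 g equivalent ,
       phi-≁-psi Km m≉0 Nm≉1 g equivalent
  where
  open QuadraticExtension R isField primePower odd 4<t card
  q≡ : q ≡ suc (q / 2 * 2)
  q≡ = ≡.trans (m≡m%n+[m/n]*n q 2) (≡.cong (ℕ._+ q / 2 * 2) odd)
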